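{- Let $\mathbf{V}$ be a variety of Heyting algebras and let $\rho^*(\mathbf{V})$ be the variety of interior algebras generated by $\{\mathcal{B}(L): L\in\mathbf{V}\}$. If $\rho^*(\mathbf{V})$ is locally finite, then $t(\mathbf{V}) = t(\rho^*(\mathbf{V}))$.
   Context: An interior algebra is a Boolean algebra with an operator $g$ satisfying $g(1)=1$, $g(x\cdot y)=g(x)\cdot g(y)$, $g(x)\le x$, $g(g(x))=g(x)$. For a Heyting algebra $L$, $\mathcal{B}(L)=\langle \mathrm{Fr}(L), g_L\rangle$ where $\mathrm{Fr}(L)$ is the free Boolean extension of $L$ and $g_L((-u_1+v_1)\cdots(-u_n+v_n)) = (u_1\Rightarrow v_1)\cdots(u_n\Rightarrow v_n)$ for $u_i,v_i\in L$. Unification: for a variety $\mathbf{W}$ and finitely presented $A\in\mathbf{W}$, a unifier is a pair $\langle u,B\rangle$ with $B$ finitely presented and projective in $\mathbf{W}$ and $u\colon A\to B$ a homomorphism; $A$ is unifiable if it has a unifier. Unifiers are quasiordered by $\langle u,B\rangle\succcurlyeq\langle v,C\rangle$ iff $v=h\circ u$ for some homomorphism $h\colon B\to C$. The type of $A$ is $1$, $\omega$, $\infty$ according as the quasiordered set of unifiers has a dense antichain ($\mu$-set) of cardinality $1$, finite $>1$, or infinite, and $0$ if it has no $\mu$-set. The type $t(\mathbf{W})$ of the variety is unitary if every unifiable algebra has type $1$; finitary if all have type $1$ or $\omega$ and some has type $\omega$; infinitary if all have type $1,\omega,\infty$ and some has type $\infty$; nullary if some algebra has type $0$ (equivalently the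 maximum of the types w.r.t. $1<\omega<\infty<0$). -}

module Defs where

open import Level using (Level; 0ℓ; _⊔_) renaming (suc to lsuc)
open import Data.Nat using (ℕ; _<_)
open import Data.Fin using (Fin)
open import Data.Fin.Patterns using (0F; 1F)
open import Data.List using (List; []; _∷_; _++_; map; foldr)
open import Data.List.Relation.Unary.All using (All)
open import Data.Product using (Σ; Σ-syntax; ∃; ∃-syntax; _×_; _,_; proj₁; proj₂)
open import Data.Sum using (_⊎_)
open import Data.Vec.Functional as V using (Vector)
open import Function using (_∘_; _↔_; StrictlySurjective)
open import Relation.Binary using (Rel; Setoid)
open import Relation.Binary.PropositionalEquality using (_≡_)
open import Relation.Binary.Lattice using (HeytingAlgebra; IsHeytingAlgebra)
open import Relation.Nullary using (¬_)
open import Algebra.Lattice.Structures using (IsBooleanAlgebra)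
import Algebra.Lattice.Structures.Biased as Biased
import Algebra.Lattice.Bundles as Alg
import Algebra.Lattice.Properties.BooleanAlgebra as BooleanProperties
import Algebra.Lattice.Properties.Lattice as LatticeProperties
import Relation.Binary.Lattice.Bundles as Ord
import Relation.Binary.Lattice.Properties.HeytingAlgebra as HeytingProperties
import Relation.Binary.Lattice.Properties.MeetSemilattice as MeetProperties
import Relation.Binary.Reasoning.Setoid as SetoidReasoning

------------------------------------------------------------------------
-- Universal algebra (over setoids)

-- S n is the type of n-ary operation symbols.
Signature : Set₁
Signature = ℕ → Set

data Term (S : Signature) (X : Set) : Set where
  var : X → Term S X
  op  : ∀ {n} → S n → (Fin n → Term S X) → Term S X

record Algebra (S : Signature) : Set₁ where
  field
    setoid : Setoid 0ℓ 0ℓ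
  open Setoid setoid public
  field
    interp      : ∀ {n} → S n → Vector Carrier n → Carrier
    interp-cong : ∀ {n} (f : S n) {xs ys : Vector Carrier n} →
                  (∀ i → xs i ≈ ys i) → interp f xs ≈ interp f ys

  eval : {X : Set} → (X → Carrier) → Term S X → Carrier
  eval ρ (var x)   = ρ x
  eval ρ (op f ts) = interp f (λ i → eval ρ (ts i))

module _ {S : Signature} where

  open Algebra using (Carrier; interp; eval)

  record Hom (A B : Algebra S) : Set where
    private
      module A = Algebra A
      module B = Algebra B
    field
      fun  : A.Carrier → B.Carrier
      cong : ∀ {x y} → x A.≈ y → fun x B.≈ fun y
      homo : ∀ {n} (f : S n) (xs : Vector A.Carrier n) →
             fun (A.interp f xs) B.≈ B.interp f (fun ∘ xs)

  open Hom public using (fun)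

  Surjective : ∀ {A B} → Hom A B → Set
  Surjective {B = B} h = StrictlySurjective (Algebra._≈_ B) (fun h)

  Holds : ∀ {X} (A : Algebra S) → (X → Carrier A) → Term S X × Term S X → Set
  Holds A ρ (s , t) = eval A ρ s A.≈ eval A ρ t
    where module A = Algebra A

  _⊨_≐_ : Algebra S → Term S ℕ → Term S ℕ → Set
  A ⊨ s ≐ t = ∀ ρ → Holds A ρ (s , t)

  -- There are finitely many elements up to _≈_.  No decision procedure for
  -- _≈_ is asked for, so this is the weakest constructive reading of "finite".
  Finite : Algebra S → Set
  Finite A = ∃[ n ] Σ[ e ∈ (Fin n → Carrier A) ] StrictlySurjective (Algebra._≈_ A) e

  FinitelyGenerated : Algebra S → Set
  FinitelyGenerated A = ∃[ n ] Σ[ a ∈ (Fin n → Carrier A) ]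
    StrictlySurjective (Algebra._≈_ A) (eval A a)

data AlgebraType : Set where
  type-1 type-ω type-∞ type-0 : AlgebraType

data UnificationType : Set where
  unitary finitary infinitary nullary : UnificationType

-- A variety is given by a set of identities.
Variety : Signature → (e : Level) → Set (lsuc e)
Variety S e = Rel (Term S ℕ) e

module _ {S : Signature} where

  infix 4 _∈ᵛ_

  _∈ᵛ_ : ∀ {e} → Algebra S → Variety S e → Set e
  A ∈ᵛ W = ∀ s t → W s t → A ⊨ s ≐ t

  -- The variety generated by a class of algebras, presented as an indexed
  -- family: the models of all the identities valid throughout the class.
  Generated : ∀ {i} {I : Set i} → (I → Algebra S) → Variety S i
  Generated {I = I} K s t = ∀ (i : I) → K i ⊨ s ≐ t

  generated-contains : ∀ {i} {I : Set i} (K : I → Algebra S) →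
                       ∀ i → K i ∈ᵛ Generated K
  generated-contains K i s t p = p i

  generated-least : ∀ {i e} {I : Set i} (K : I → Algebra S) (W : Variety S e) →
                    (∀ i → K i ∈ᵛ W) → ∀ A → A ∈ᵛ Generated K → A ∈ᵛ W
  generated-least K W K⊆W A A∈ s t p = A∈ s t (λ i → K⊆W i s t p)

  LocallyFinite : ∀ {e} → Variety S e → Set (lsuc 0ℓ ⊔ e)
  LocallyFinite W = ∀ A → A ∈ᵛ W → FinitelyGenerated A → Finite A

------------------------------------------------------------------------
-- Unification

  module _ {e} (W : Variety S e) where

    open Algebra using (Carrier)

    -- A is the algebra of W presented by finitely many generators and
    -- finitely many relations.
    record FinitelyPresented (A : Algebra S) : Set (lsuc 0ℓ ⊔ e) where
      private module A = Algebra A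
      field
        #gens     : ℕ
        relations : List (Term S (Fin #gens) × Term S (Fin #gens))
        gens      : Fin #gens → A.Carrier
        satisfied : All (Holds A gens) relations
        extend    : ∀ C → C ∈ᵛ W → (c : Fin #gens → Carrier C) →
                    All (Holds C c) relations →
                    Σ[ h ∈ Hom A C ] (∀ i → Algebra._≈_ C (fun h (gens i)) (c i))
        unique    : ∀ C → C ∈ᵛ W → (h k : Hom A C) →
                    (∀ i → Algebra._≈_ C (fun h (gens i)) (fun k (gens i))) →
                    ∀ x → Algebra._≈_ C (fun h x) (fun k x)

    Projective : Algebra S → Set (lsuc 0ℓ ⊔ e)
    Projective P = ∀ C D → C ∈ᵛ W → D ∈ᵛ W →
      (q : Hom C D) → Surjective q → (f : Hom P D) →
      Σ[ h ∈ Hom P C ] (∀ x → Algebra._≈_ D (fun q (fun h x)) (fun f x))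

    record Unifier (A : Algebra S) : Set (lsuc 0ℓ ⊔ e) where
      field
        target            : Algebra S
        target∈W          : target ∈ᵛ W
        finitelyPresented : FinitelyPresented target
        projective        : Projective target
        unifier           : Hom A target

    module _ {A : Algebra S} where

      open Unifier

      infix 4 _≽_

      _≽_ : Unifier A → Unifier A → Set
      u ≽ v = Σ[ h ∈ Hom (target u) (target v) ]
        (∀ x → Algebra._≈_ (target v) (fun (unifier v) x) (fun h (fun (unifier u) x)))

    -- A dense antichain, as a family indexed without repetition.
    record μ-Set (A : Algebra S) : Set (lsuc (lsuc 0ℓ ⊔ e)) where
      field
        Index     : Set (lsuc 0ℓ ⊔ e)
        member    : Index → Unifier A
        antichain : ∀ i j → member i ≽ member j → i ≡ j
        dense     : ∀ (v : Unifier A) → ∃[ i ] (member i ≽ v)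

    HasAlgebraType : Algebra S → AlgebraType → Set (lsuc (lsuc 0ℓ ⊔ e))
    HasAlgebraType A type-1 = Σ[ M ∈ μ-Set A ] (μ-Set.Index M ↔ Fin 1)
    HasAlgebraType A type-ω = Σ[ M ∈ μ-Set A ]
      ∃[ n ] (1 < n × (μ-Set.Index M ↔ Fin n))
    HasAlgebraType A type-∞ = Σ[ M ∈ μ-Set A ]
      (¬ (∃[ n ] (μ-Set.Index M ↔ Fin n)))
    HasAlgebraType A type-0 = ¬ μ-Set A

    -- A finitely presented algebra of W that has a unifier.
    record UnifiableAlgebra : Set (lsuc 0ℓ ⊔ e) where
      field
        algebra           : Algebra S
        algebra∈W         : algebra ∈ᵛ W
        finitelyPresented : FinitelyPresented algebra
        someUnifier       : Unifier algebra

-- The graph of W ↦ t(W).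
HasUnificationType : ∀ {S e} → Variety S e → UnificationType →
                     Set (lsuc (lsuc 0ℓ ⊔ e))
HasUnificationType W = λ where
    unitary    → ∀ A → A hasType type-1
    finitary   → (∀ A → A hasType type-1 ⊎ A hasType type-ω)
               × (∃[ A ] A hasType type-ω)
    infinitary → (∀ A → A hasType type-1 ⊎ A hasType type-ω ⊎ A hasType type-∞)
               × (∃[ A ] A hasType type-∞)
    nullary    → ∃[ A ] A hasType type-0
  where
  _hasType_ : UnifiableAlgebra W → AlgebraType → Set _
  A hasType τ = HasAlgebraType W (UnifiableAlgebra.algebra A) τ

------------------------------------------------------------------------
-- Heyting algebras and interior algebras

data HeytingSignature : Signature where
  ∨ˢ ∧ˢ ⇒ˢ : HeytingSignature 2
  ⊤ˢ ⊥ˢ    : HeytingSignature 0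

module HeytingOperations (A : Algebra HeytingSignature) where

  open Algebra A public

  _∨_ _∧_ _⇒_ : Carrier → Carrier → Carrier
  x ∨ y = interp ∨ˢ (x V.∷ y V.∷ V.[])
  x ∧ y = interp ∧ˢ (x V.∷ y V.∷ V.[])
  x ⇒ y = interp ⇒ˢ (x V.∷ y V.∷ V.[])

  ⊤ ⊥ : Carrier
  ⊤ = interp ⊤ˢ V.[]
  ⊥ = interp ⊥ˢ V.[]

  _≤_ : Rel Carrier 0ℓ
  x ≤ y = (x ∧ y) ≈ x

IsHeyting : Algebra HeytingSignature → Set
IsHeyting A = IsHeytingAlgebra _≈_ _≤_ _∨_ _∧_ _⇒_ ⊤ ⊥
  where open HeytingOperations A

heytingAlgebra : (A : Algebra HeytingSignature) → IsHeyting A → HeytingAlgebra 0ℓ 0ℓ 0ℓ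
heytingAlgebra A isHeyting = record { isHeytingAlgebra = isHeyting }

record HeytingVariety : Set₁ where
  field
    variety : Variety HeytingSignature 0ℓ
    heyting : ∀ A → A ∈ᵛ variety → IsHeyting A

data InteriorSignature : Signature where
  +ˢ ·ˢ : InteriorSignature 2
  -ˢ gˢ : InteriorSignature 1
  𝟙ˢ 𝟘ˢ : InteriorSignature 0

module InteriorOperations (A : Algebra InteriorSignature) where

  open Algebra A public

  infixl 6 _+_
  infixl 7 _·_
  infix  8 -_

  _+_ _·_ : Carrier → Carrier → Carrier
  x + y = interp +ˢ (x V.∷ y V.∷ V.[])
  x · y = interp ·ˢ (x V.∷ y V.∷ V.[])

  -_ g : Carrier → Carrier
  - x = interp -ˢ (x V.∷ V.[])
  g x = interp gˢ (x V.∷ V.[])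

  𝟙 𝟘 : Carrier
  𝟙 = interp 𝟙ˢ V.[]
  𝟘 = interp 𝟘ˢ V.[]

record IsInterior (A : Algebra InteriorSignature) : Set where
  open InteriorOperations A
  field
    isBooleanAlgebra : IsBooleanAlgebra _≈_ _+_ _·_ -_ 𝟙 𝟘
    g-𝟙              : g 𝟙 ≈ 𝟙
    g-·              : ∀ x y → g (x · y) ≈ g x · g y
    g-≤              : ∀ x → g x · x ≈ g x
    g-g              : ∀ x → g (g x) ≈ g x

------------------------------------------------------------------------
-- The free Boolean extension Fr(L) and the interior algebra 𝓑(L)

module FreeBooleanExtension (L : HeytingAlgebra 0ℓ 0ℓ 0ℓ) where

  private
    open module L = HeytingAlgebra L
      using (_≤_; _∨_; _∧_; _⇨_; ⊤; ⊥; ∨-least; ∧-greatest; x≤x∨y; y≤x∨y; x∧y≤x; x∧y≤y)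
    open HeytingProperties L using (⇨-eval; ⇨-cong; y≤x⇨y; ⇨ˡ-contravariant)
    open MeetProperties L.meetSemilattice using (∧-comm; ∧-cong; ∧-assoc; ∧-monotonic)

  infix  4 _≃_
  infixl 6 _+_
  infixl 7 _·_
  infix  8 -_

  data Fr : Set where
    ι       : L.Carrier → Fr
    _+_ _·_ : Fr → Fr → Fr
    -_      : Fr → Fr
    𝟙 𝟘     : Fr

  -- The least Boolean algebra congruence on formal Boolean combinations of
  -- elements of L that makes ι a homomorphism of bounded lattices.
  data _≃_ : Rel Fr 0ℓ where
    ≃-refl  : ∀ {x} → x ≃ x
    ≃-sym   : ∀ {x y} → x ≃ y → y ≃ x
    ≃-trans : ∀ {x y z} → x ≃ y → y ≃ z → x ≃ z

    +-cong : ∀ {x x′ y y′} → x ≃ x′ → y ≃ y′ → x + y ≃ x′ + y′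
    ·-cong : ∀ {x x′ y y′} → x ≃ x′ → y ≃ y′ → x · y ≃ x′ · y′
    -‿cong : ∀ {x x′} → x ≃ x′ → - x ≃ - x′

    +-comm       : ∀ x y → x + y ≃ y + x
    +-assoc      : ∀ x y z → (x + y) + z ≃ x + (y + z)
    ·-comm       : ∀ x y → x · y ≃ y · x
    ·-assoc      : ∀ x y z → (x · y) · z ≃ x · (y · z)
    +-absorbs-·  : ∀ x y → x + x · y ≃ x
    ·-absorbs-+  : ∀ x y → x · (x + y) ≃ x
    +-distribʳ-· : ∀ x y z → y · z + x ≃ (y + x) · (z + x)
    +-complement : ∀ x → x + - x ≃ 𝟙
    ·-complement : ∀ x → x · - x ≃ 𝟘

    ι-cong : ∀ {a b} → a L.≈ b → ι a ≃ ι b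
    ι-∨    : ∀ a b → ι (a ∨ b) ≃ ι a + ι b
    ι-∧    : ∀ a b → ι (a ∧ b) ≃ ι a · ι b
    ι-⊤    : ι ⊤ ≃ 𝟙
    ι-⊥    : ι ⊥ ≃ 𝟘

  Fr-isBooleanAlgebra : IsBooleanAlgebra _≃_ _+_ _·_ -_ 𝟙 𝟘
  Fr-isBooleanAlgebra = Biased.isBooleanAlgebraʳ record
    { isDistributiveLattice = Biased.isDistributiveLatticeʳʲᵐ record
      { isLattice = record
        { isEquivalence = record { refl = ≃-refl ; sym = ≃-sym ; trans = ≃-trans }
        ; ∨-comm        = +-comm
        ; ∨-assoc       = +-assoc
        ; ∨-cong        = +-cong
        ; ∧-comm        = ·-comm
        ; ∧-assoc       = ·-assoc
        ; ∧-cong        = ·-cong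
        ; absorptive    = +-absorbs-· , ·-absorbs-+
        }
      ; ∨-distribʳ-∧ = +-distribʳ-·
      }
    ; ∨-complementʳ = +-complement
    ; ∧-complementʳ = ·-complement
    ; ¬-cong        = -‿cong
    }

  Fr-booleanAlgebra : Alg.BooleanAlgebra 0ℓ 0ℓ
  Fr-booleanAlgebra = record { isBooleanAlgebra = Fr-isBooleanAlgebra }

  private
    module F  = Alg.BooleanAlgebra Fr-booleanAlgebra
    module FP = BooleanProperties Fr-booleanAlgebra
    module FO = Ord.Lattice (LatticeProperties.∨-∧-orderTheoreticLattice F.lattice)

  open FO public using () renaming (_≤_ to _⊑_)

  -- (u , v) stands for - u + v, and a list for the product of its entries.
  Clauses : Set
  Clauses = List (L.Carrier × L.Carrier)

  ∏ : Clauses → Fr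
  ∏ = foldr (λ (u , v) x → (- ι u + ι v) · x) 𝟙

  ⋀⇒ : Clauses → L.Carrier
  ⋀⇒ = foldr (λ (u , v) a → (u ⇨ v) ∧ a) ⊤

  sumᶜ : L.Carrier × L.Carrier → Clauses → Clauses
  sumᶜ (u , v) = map (λ (u′ , v′) → (u ∧ u′) , (v ∨ v′))

  sum : Clauses → Clauses → Clauses
  sum []       ds = []
  sum (c ∷ cs) ds = sumᶜ c ds ++ sum cs ds

  complement : Clauses → Clauses
  complement []             = (⊤ , ⊥) ∷ []
  complement ((u , v) ∷ cs) = sum ((⊤ , u) ∷ (v , ⊥) ∷ []) (complement cs)

  normalForm : Fr → Clauses
  normalForm (ι a)   = (⊤ , a) ∷ []
  normalForm (x + y) = sum (normalForm x) (normalForm y)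
  normalForm (x · y) = normalForm x ++ normalForm y
  normalForm (- x)   = complement (normalForm x)
  normalForm 𝟙       = []
  normalForm 𝟘       = (⊤ , ⊥) ∷ []

  gᴸ : Fr → L.Carrier
  gᴸ x = ⋀⇒ (normalForm x)

  g : Fr → Fr
  g x = ι (gᴸ x)

  private
    open SetoidReasoning F.setoid

  +-congʳ : ∀ {x y z} → y ≃ z → x + y ≃ x + z
  +-congʳ = +-cong ≃-refl

  ·-congʳ : ∀ {x y z} → y ≃ z → x · y ≃ x · z
  ·-congʳ = ·-cong ≃-refl

  ∏-++ : ∀ cs ds → ∏ (cs ++ ds) ≃ ∏ cs · ∏ ds
  ∏-++ []       ds = ≃-sym (FP.∧-identityˡ _)
  ∏-++ (c ∷ cs) ds = ≃-trans (·-congʳ (∏-++ cs ds)) (≃-sym (·-assoc _ _ _))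

  interchange : ∀ w x y z → (w + x) + (y + z) ≃ (w + y) + (x + z)
  interchange w x y z = begin
    (w + x) + (y + z)  ≈⟨ +-assoc _ _ _ ⟩
    w + (x + (y + z))  ≈⟨ +-congʳ (≃-sym (+-assoc _ _ _)) ⟩
    w + ((x + y) + z)  ≈⟨ +-congʳ (+-cong (+-comm _ _) ≃-refl) ⟩
    w + ((y + x) + z)  ≈⟨ +-congʳ (+-assoc _ _ _) ⟩
    w + (y + (x + z))  ≈⟨ +-assoc _ _ _ ⟨
    (w + y) + (x + z)  ∎

  clause-sum : ∀ u v u′ v′ →
    - ι (u ∧ u′) + ι (v ∨ v′) ≃ (- ι u + ι v) + (- ι u′ + ι v′)
  clause-sum u v u′ v′ = begin
    - ι (u ∧ u′) + ι (v ∨ v′)          ≈⟨ +-cong (-‿cong (ι-∧ u u′)) (ι-∨ v v′) ⟩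
    - (ι u · ι u′) + (ι v + ι v′)      ≈⟨ +-cong (FP.deMorgan₁ _ _) ≃-refl ⟩
    (- ι u + - ι u′) + (ι v + ι v′)    ≈⟨ interchange _ _ _ _ ⟩
    (- ι u + ι v) + (- ι u′ + ι v′)    ∎

  ∏-sumᶜ : ∀ u v ds → ∏ (sumᶜ (u , v) ds) ≃ (- ι u + ι v) + ∏ ds
  ∏-sumᶜ u v []               = ≃-sym (FP.∨-zeroʳ _)
  ∏-sumᶜ u v ((u′ , v′) ∷ ds) =
    ≃-trans (·-cong (clause-sum u v u′ v′) (∏-sumᶜ u v ds))
            (≃-sym (F.∨-distribˡ-∧ _ _ _))

  ∏-sum : ∀ cs ds → ∏ (sum cs ds) ≃ ∏ cs + ∏ ds
  ∏-sum []             ds = ≃-sym (FP.∨-zeroˡ _)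
  ∏-sum ((u , v) ∷ cs) ds = begin
    ∏ (sumᶜ (u , v) ds ++ sum cs ds)                ≈⟨ ∏-++ (sumᶜ (u , v) ds) _ ⟩
    ∏ (sumᶜ (u , v) ds) · ∏ (sum cs ds)             ≈⟨ ·-cong (∏-sumᶜ u v ds) (∏-sum cs ds) ⟩
    ((- ι u + ι v) + ∏ ds) · (∏ cs + ∏ ds)          ≈⟨ +-distribʳ-· _ _ _ ⟨
    (- ι u + ι v) · ∏ cs + ∏ ds                     ∎

  clause-⊤ : ∀ a → - ι ⊤ + ι a ≃ ι a
  clause-⊤ a = ≃-trans (+-cong (≃-trans (-‿cong ι-⊤) FP.¬⊤≈⊥) ≃-refl) (FP.∨-identityˡ _)

  clause-⊥ : ∀ a → - ι a + ι ⊥ ≃ - ι a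
  clause-⊥ a = ≃-trans (+-congʳ ι-⊥) (FP.∨-identityʳ _)

  ∏-𝟘 : ∏ ((⊤ , ⊥) ∷ []) ≃ 𝟘
  ∏-𝟘 = ≃-trans (FP.∧-identityʳ _) (≃-trans (clause-⊤ ⊥) ι-⊥)

  ∏-complement : ∀ cs → ∏ (complement cs) ≃ - ∏ cs
  ∏-complement []             = ≃-trans ∏-𝟘 (≃-sym FP.¬⊤≈⊥)
  ∏-complement ((u , v) ∷ cs) = begin
    ∏ (sum ((⊤ , u) ∷ (v , ⊥) ∷ []) (complement cs))
      ≈⟨ ∏-sum ((⊤ , u) ∷ (v , ⊥) ∷ []) (complement cs) ⟩
    (- ι ⊤ + ι u) · ((- ι v + ι ⊥) · 𝟙) + ∏ (complement cs)
      ≈⟨ +-cong (·-cong (clause-⊤ u) (≃-trans (FP.∧-identityʳ _) (clause-⊥ v))) (∏-complement cs) ⟩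
    ι u · - ι v + - ∏ cs
      ≈⟨ +-cong (·-cong (≃-sym (FP.¬-involutive _)) ≃-refl) ≃-refl ⟩
    - - ι u · - ι v + - ∏ cs
      ≈⟨ +-cong (≃-sym (FP.deMorgan₂ _ _)) ≃-refl ⟩
    - (- ι u + ι v) + - ∏ cs
      ≈⟨ FP.deMorgan₁ _ _ ⟨
    - ((- ι u + ι v) · ∏ cs) ∎

  normalForm-correct : ∀ x → ∏ (normalForm x) ≃ x
  normalForm-correct (ι a)   = ≃-trans (FP.∧-identityʳ _) (clause-⊤ a)
  normalForm-correct (x + y) = ≃-trans (∏-sum (normalForm x) (normalForm y))
                                 (+-cong (normalForm-correct x) (normalForm-correct y))
  normalForm-correct (x · y) = ≃-trans (∏-++ (normalForm x) (normalForm y))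
                                 (·-cong (normalForm-correct x) (normalForm-correct y))
  normalForm-correct (- x)   = ≃-trans (∏-complement (normalForm x))
                                 (-‿cong (normalForm-correct x))
  normalForm-correct 𝟙       = ≃-refl
  normalForm-correct 𝟘       = ∏-𝟘

  -- For c in L, the fixed points of the nucleus j a = (a ⇨ c) ⇨ c form a
  -- Boolean algebra, and j is a bounded lattice homomorphism onto it.
  module Nucleus (c : L.Carrier) where

    j : L.Carrier → L.Carrier
    j a = (a ⇨ c) ⇨ c

    infixl 6 _⊕_

    _⊕_ : L.Carrier → L.Carrier → L.Carrier
    a ⊕ b = j (a ∨ b)

    Fixed : L.Carrier → Set
    Fixed a = j a ≤ a

    mp : ∀ {a b d} → a ≤ (b ⇨ d) → a ≤ b → a ≤ d
    mp p q = L.trans (∧-greatest p q) ⇨-eval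

    ∧-swap : ∀ {a b} → (a ∧ b) ≤ (b ∧ a)
    ∧-swap = L.reflexive (∧-comm _ _)

    unit : ∀ {a} → a ≤ j a
    unit = L.transpose-⇨ (mp (x∧y≤y _ _) (x∧y≤x _ _))

    exp-fixed : ∀ {a} → Fixed (a ⇨ c)
    exp-fixed = ⇨ˡ-contravariant unit

    j-mono : ∀ {a b} → a ≤ b → j a ≤ j b
    j-mono p = ⇨ˡ-contravariant (⇨ˡ-contravariant p)

    j-cong : ∀ {a b} → a L.≈ b → j a L.≈ j b
    j-cong p = ⇨-cong (⇨-cong p L.Eq.refl) L.Eq.refl

    c≤fixed : ∀ {a} → Fixed a → c ≤ a
    c≤fixed p = L.trans y≤x⇨y p

    -- x ∧ j a ≤ b follows from x ∧ a ≤ b when b is fixed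
    j-elim : ∀ {x a b} → Fixed b → (x ∧ a) ≤ b → (x ∧ j a) ≤ b
    j-elim fb p = L.trans (L.transpose-⇨ (mp (L.trans (x∧y≤x _ _) (x∧y≤y _ _))
      (L.transpose-⇨ (mp (L.trans (x∧y≤x _ _) (x∧y≤y _ _))
        (L.trans (∧-greatest (L.trans (x∧y≤x _ _) (L.trans (x∧y≤x _ _) (x∧y≤x _ _))) (x∧y≤y _ _)) p))))) fb

    j-∧ : ∀ {a b} → (j a ∧ j b) ≤ j (a ∧ b)
    j-∧ = j-elim exp-fixed (L.trans ∧-swap
            (j-elim exp-fixed (L.trans ∧-swap unit)))

    ∧-fixed : ∀ {a b} → Fixed a → Fixed b → Fixed (a ∧ b)
    ∧-fixed fa fb = ∧-greatest (L.trans (j-mono (x∧y≤x _ _)) fa) (L.trans (j-mono (x∧y≤y _ _)) fb)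

    inˡ : ∀ {a b} → a ≤ (a ⊕ b)
    inˡ = L.trans (x≤x∨y _ _) unit

    inʳ : ∀ {a b} → b ≤ (a ⊕ b)
    inʳ = L.trans (y≤x∨y _ _) unit

    ⊕-elim : ∀ {x a b d} → Fixed d → (x ∧ a) ≤ d → (x ∧ b) ≤ d → (x ∧ (a ⊕ b)) ≤ d
    ⊕-elim fd p q = j-elim fd (L.trans ∧-swap (L.transpose-∧
      (∨-least (L.transpose-⇨ (L.trans ∧-swap p)) (L.transpose-⇨ (L.trans ∧-swap q)))))

    ⊕-least : ∀ {a b d} → Fixed d → a ≤ d → b ≤ d → (a ⊕ b) ≤ d
    ⊕-least fd p q = L.trans (j-mono (∨-least p q)) fd

    ⊕-mono : ∀ {a a′ b b′} → a ≤ a′ → b ≤ b′ → (a ⊕ b) ≤ (a′ ⊕ b′)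
    ⊕-mono p q = ⊕-least exp-fixed (L.trans p inˡ) (L.trans q inʳ)

    ⟦_⟧ : Fr → L.Carrier
    ⟦ ι a ⟧   = j a
    ⟦ x + y ⟧ = ⟦ x ⟧ ⊕ ⟦ y ⟧
    ⟦ x · y ⟧ = ⟦ x ⟧ ∧ ⟦ y ⟧
    ⟦ - x ⟧   = ⟦ x ⟧ ⇨ c
    ⟦ 𝟙 ⟧     = ⊤
    ⟦ 𝟘 ⟧     = c

    fixed : ∀ x → Fixed ⟦ x ⟧
    fixed (ι a)   = exp-fixed
    fixed (x + y) = exp-fixed
    fixed (x · y) = ∧-fixed (fixed x) (fixed y)
    fixed (- x)   = exp-fixed
    fixed 𝟙       = L.maximum _
    fixed 𝟘       = mp L.refl (L.transpose-⇨ (x∧y≤y _ _))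

    sound : ∀ {x y} → x ≃ y → ⟦ x ⟧ L.≈ ⟦ y ⟧
    sound ≃-refl = L.Eq.refl
    sound (≃-sym p) = L.Eq.sym (sound p)
    sound (≃-trans p q) = L.Eq.trans (sound p) (sound q)
    sound (+-cong p q) = L.antisym
      (⊕-mono (L.reflexive (sound p)) (L.reflexive (sound q)))
      (⊕-mono (L.reflexive (L.Eq.sym (sound p))) (L.reflexive (L.Eq.sym (sound q))))
    sound (·-cong p q) = ∧-cong (sound p) (sound q)
    sound (-‿cong p) = ⇨-cong (sound p) L.Eq.refl
    sound (+-comm x y) = L.antisym (⊕-least exp-fixed inʳ inˡ) (⊕-least exp-fixed inʳ inˡ)
    sound (+-assoc x y z) = L.antisym
      (⊕-least exp-fixed (⊕-least exp-fixed inˡ (L.trans inˡ inʳ)) (L.trans inʳ inʳ))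
      (⊕-least exp-fixed (L.trans inˡ inˡ) (⊕-least exp-fixed (L.trans inʳ inˡ) inʳ))
    sound (·-comm x y) = ∧-comm _ _
    sound (·-assoc x y z) = ∧-assoc _ _ _
    sound (+-absorbs-· x y) = L.antisym (⊕-least (fixed x) L.refl (x∧y≤x _ _)) inˡ
    sound (·-absorbs-+ x y) = L.antisym (x∧y≤x _ _) (∧-greatest L.refl inˡ)
    sound (+-distribʳ-· x y z) = L.antisym
      (⊕-least (∧-fixed exp-fixed exp-fixed)
        (∧-monotonic inˡ inˡ)
        (∧-greatest inʳ inʳ))
      (⊕-elim exp-fixed
        (L.trans ∧-swap (⊕-elim exp-fixed (L.trans ∧-swap inˡ) (L.trans (x∧y≤y _ _) inʳ)))
        (L.trans (x∧y≤y _ _) inʳ))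
    sound (+-complement x) = L.antisym (L.maximum _)
      (L.transpose-⇨ (mp (x∧y≤y _ _)
        (L.trans (x∧y≤y _ _) (L.trans (⇨ˡ-contravariant (x≤x∨y _ _)) (y≤x∨y _ _)))))
    sound (·-complement x) = L.antisym (mp (x∧y≤y _ _) (x∧y≤x _ _))
      (∧-greatest (c≤fixed (fixed x)) y≤x⇨y)
    sound (ι-cong p) = j-cong p
    sound (ι-∨ a b) = L.antisym (j-mono (∨-least (L.trans unit (x≤x∨y _ _)) (L.trans unit (y≤x∨y _ _))))
      (⊕-least exp-fixed (j-mono (x≤x∨y _ _)) (j-mono (y≤x∨y _ _)))
    sound (ι-∧ a b) = L.antisym (∧-greatest (j-mono (x∧y≤x _ _)) (j-mono (x∧y≤y _ _))) j-∧
    sound ι-⊤ = L.antisym (L.maximum _) unit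
    sound ι-⊥ = L.antisym (mp L.refl (L.transpose-⇨ (L.trans (x∧y≤y _ _) (L.minimum _)))) y≤x⇨y

  ι-reflects-≤ : ∀ {a b} → ι a ⊑ ι b → a ≤ b
  ι-reflects-≤ {a} {b} p = L.trans unit (L.trans (L.reflexive (sound p))
      (L.trans (x∧y≤y _ _) (mp L.refl (L.transpose-⇨ (x∧y≤y _ _)))))
    where open Nucleus b

  ι-mono : ∀ {a b} → a ≤ b → ι a ⊑ ι b
  ι-mono p = ≃-trans
    (ι-cong (L.antisym (∧-greatest L.refl p) (x∧y≤x _ _))) (ι-∧ _ _)

  -- x · y ⊑ z iff x ⊑ - y + z
  residuate : ∀ {x y z} → (x · y) ⊑ z → x ⊑ (- y + z)
  residuate {x} {y} {z} p = FO.trans (FO.reflexive eq)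
      (FO.∨-least (FO.trans p (FO.y≤x∨y _ _)) (FO.trans (FO.x∧y≤y _ _) (FO.x≤x∨y _ _)))
    where
    eq : x ≃ x · y + x · - y
    eq = begin
      x                ≈⟨ FP.∧-identityʳ _ ⟨
      x · 𝟙            ≈⟨ ·-congʳ (+-complement y) ⟨
      x · (y + - y)    ≈⟨ F.∧-distribˡ-∨ _ _ _ ⟩
      x · y + x · - y  ∎

  unresiduate : ∀ {x y z} → x ⊑ (- y + z) → (x · y) ⊑ z
  unresiduate {x} {y} {z} p = FO.trans
      (FO.∧-greatest (FO.trans (FO.x∧y≤x _ _) p) (FO.x∧y≤y _ _))
      (FO.trans (FO.reflexive eq) (FO.x∧y≤x _ _))
    where
    eq : (- y + z) · y ≃ z · y
    eq = begin
      (- y + z) · y      ≈⟨ F.∧-distribʳ-∨ _ _ _ ⟩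
      - y · y + z · y    ≈⟨ +-cong (F.∧-complementˡ _) ≃-refl ⟩
      𝟘 + z · y          ≈⟨ FP.∨-identityˡ _ ⟩
      z · y              ∎

  below→ : ∀ cs {a} → a ≤ ⋀⇒ cs → ι a ⊑ ∏ cs
  below→ []             p = ≃-sym (FP.∧-identityʳ _)
  below→ ((u , v) ∷ cs) p = FO.∧-greatest
    (residuate (FO.trans (FO.reflexive (≃-sym (ι-∧ _ _)))
      (ι-mono (L.transpose-∧ (L.trans p (x∧y≤x _ _))))))
    (below→ cs (L.trans p (x∧y≤y _ _)))

  below← : ∀ cs {a} → ι a ⊑ ∏ cs → a ≤ ⋀⇒ cs
  below← []             p = L.maximum _
  below← ((u , v) ∷ cs) p = ∧-greatest
    (L.transpose-⇨ (ι-reflects-≤ (FO.trans (FO.reflexive (ι-∧ _ _))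
      (unresiduate (FO.trans p (FO.x∧y≤x _ _))))))
    (below← cs (FO.trans p (FO.x∧y≤y _ _)))

  g→ : ∀ x {a} → a ≤ gᴸ x → ι a ⊑ x
  g→ x p = FO.trans (below→ (normalForm x) p) (FO.reflexive (normalForm-correct x))

  g← : ∀ x {a} → ι a ⊑ x → a ≤ gᴸ x
  g← x p = below← (normalForm x) (FO.trans p (FO.reflexive (≃-sym (normalForm-correct x))))

  gᴸ-mono : ∀ {x y} → x ⊑ y → gᴸ x ≤ gᴸ y
  gᴸ-mono {x} {y} p = g← y (FO.trans (g→ x L.refl) p)

  g-cong : ∀ {x y} → x ≃ y → g x ≃ g y
  g-cong p = ι-cong (L.antisym (gᴸ-mono (FO.reflexive p)) (gᴸ-mono (FO.reflexive (≃-sym p))))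

  -- g ((- u₁ + v₁) ⋯ (- uₙ + vₙ)) = (u₁ ⇒ v₁) ⋯ (uₙ ⇒ vₙ)
  g-formula : ∀ cs → g (∏ cs) ≃ ι (⋀⇒ cs)
  g-formula cs = ι-cong (L.antisym (below← cs (g→ (∏ cs) L.refl)) (g← (∏ cs) (below→ cs L.refl)))

  𝓑 : Algebra InteriorSignature
  𝓑 = record
    { setoid      = F.setoid
    ; interp      = λ where
        +ˢ xs → xs 0F + xs 1F
        ·ˢ xs → xs 0F · xs 1F
        -ˢ xs → - xs 0F
        gˢ xs → g (xs 0F)
        𝟙ˢ xs → 𝟙
        𝟘ˢ xs → 𝟘
    ; interp-cong = λ where
        +ˢ p → +-cong (p 0F) (p 1F)
        ·ˢ p → ·-cong (p 0F) (p 1F)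
        -ˢ p → -‿cong (p 0F)
        gˢ p → g-cong (p 0F)
        𝟙ˢ p → ≃-refl
        𝟘ˢ p → ≃-refl
    }

  𝓑-isInterior : IsInterior 𝓑
  𝓑-isInterior = record
    { isBooleanAlgebra = Fr-isBooleanAlgebra
    ; g-𝟙 = ι-⊤
    ; g-· = λ x y → ≃-trans
        (ι-cong (L.antisym
          (∧-greatest (gᴸ-mono (FO.x∧y≤x x y)) (gᴸ-mono (FO.x∧y≤y x y)))
          (g← (x · y) (FO.∧-greatest (g→ x (x∧y≤x _ _)) (g→ y (x∧y≤y _ _))))))
        (ι-∧ _ _)
    ; g-≤ = λ x → ≃-sym (g→ x L.refl)
    ; g-g = λ x → ι-cong (L.antisym (ι-reflects-≤ (g→ (g x) L.refl)) (g← (g x) FO.refl))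
    }

open FreeBooleanExtension public using (𝓑)

-- Generated over the interior algebra signature: being an interior algebra is
-- equational, so by 𝓑-isInterior every member is one.
ρ* : HeytingVariety → Variety InteriorSignature (lsuc 0ℓ)
ρ* V = Generated {I = ∃[ L ] (L ∈ᵛ variety)} (λ (L , L∈V) → 𝓑 (heytingAlgebra L (heyting L L∈V)))
  where open HeytingVariety V

{-# OPTIONS --safe #-}
module Submission where

-- The functor 𝓑 is left adjoint to the functor O taking an interior algebra of
-- ρ*(V) to its Heyting algebra of open elements, which lies in V by the Gödel
-- translation.  The unit L → O 𝓑 L is an isomorphism and the counit
-- ε : 𝓑 O A → A is injective.  Every 𝓑 L satisfies the Grzegorczyk identity,
-- hence so does every A in ρ*(V).  In a finite A the increasing sequence of
-- opens s₀ = 0, sₖ₊₁ = g (- x + g (x + sₖ)) becomes constant, and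
-- its limit is 1 by the Grzegorczyk identity; as each x · sₖ is a Boolean combination of
-- opens, so is x, and ε is an isomorphism.  By local finiteness this applies to
-- all finitely presented A.  Therefore 𝓑 and O restrict to an equivalence
-- between finitely presented algebras that preserves projectivity, and the
-- quasiorders of unifiers of L and of 𝓑 L are equivalent.

open import Defs
open import Level using (0ℓ; _⊔_) renaming (suc to lsuc)
open import Data.Nat using (ℕ; zero; suc)
open import Data.Nat.Properties using (n<1+n; ≤⇒≤′)
import Data.Nat as ℕ
open import Data.Fin using (Fin; toℕ)
open import Data.Fin.Patterns using (0F; 1F)
open import Data.Fin.Properties using (pigeonhole)
open import Data.List using (List; []; _∷_; _++_; map; tabulate)
open import Data.List.Relation.Unary.All as All using (All)
import Data.List.Relation.Unary.All.Properties as All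
open import Data.Product using (Σ-syntax; ∃-syntax; _×_; _,_; proj₁; proj₂)
import Data.Product as Product
import Data.Sum as Sum
import Data.Vec.Functional as V
open import Function using (_⇔_; mk⇔; _∘_; id; Equivalence)
open import Relation.Binary using (Rel)
open import Relation.Binary.PropositionalEquality as ≡ using (_≡_)
import Algebra.Lattice.Bundles as Alg
import Algebra.Lattice.Properties.BooleanAlgebra as BooleanProperties
import Algebra.Lattice.Properties.Lattice as LatticeProperties
import Algebra.Lattice.Structures.Biased as Biased
import Relation.Binary.Lattice.Bundles as Ord
import Relation.Binary.Reasoning.Setoid as SetoidReasoning

-- Homomorphisms, generated subalgebras and free algebras over an arbitrary signature.

module _ {S : Signature} where

  open Algebra using (Carrier; eval)

  idʰ : {A : Algebra S} → Hom A A
  idʰ {A} = record { fun = id ; cong = id ; homo = λ _ _ → Algebra.refl A }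

  infixr 9 _∘ʰ_

  _∘ʰ_ : {A B C : Algebra S} → Hom B C → Hom A B → Hom A C
  _∘ʰ_ {C = C} h k = record
    { fun  = fun h ∘ fun k
    ; cong = Hom.cong h ∘ Hom.cong k
    ; homo = λ f xs → Algebra.trans C (Hom.cong h (Hom.homo k f xs)) (Hom.homo h f _)
    }

  eval-cong : ∀ {X} (A : Algebra S) {ρ σ : X → Carrier A} →
              (∀ x → Algebra._≈_ A (ρ x) (σ x)) →
              ∀ t → Algebra._≈_ A (eval A ρ t) (eval A σ t)
  eval-cong A p (var x)   = p x
  eval-cong A p (op f ts) = Algebra.interp-cong A f (λ i → eval-cong A p (ts i))

  module _ (A : Algebra S) where

    open Algebra A hiding (Carrier)

    interp-η₀ : ∀ (f : S 0) xs → interp f xs ≈ interp f V.[]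
    interp-η₀ f xs = interp-cong f λ ()

    interp-η₁ : ∀ (f : S 1) xs → interp f xs ≈ interp f (xs 0F V.∷ V.[])
    interp-η₁ f xs = interp-cong f λ where 0F → refl

    interp-η₂ : ∀ (f : S 2) xs → interp f xs ≈ interp f (xs 0F V.∷ xs 1F V.∷ V.[])
    interp-η₂ f xs = interp-cong f λ where
      0F → refl
      1F → refl

  module _ {A B : Algebra S} (h : Hom A B) where

    private
      module A = Algebra A
      module B = Algebra B

    eval-hom : ∀ {X} (ρ : X → Carrier A) t →
               fun h (eval A ρ t) B.≈ eval B (fun h ∘ ρ) t
    eval-hom ρ (var x)   = B.refl
    eval-hom ρ (op f ts) =
      B.trans (Hom.homo h f _) (B.interp-cong f (λ i → eval-hom ρ (ts i)))

    Injective : Set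
    Injective = ∀ {x y} → fun h x B.≈ fun h y → x A.≈ y

    reflects-Holds : Injective → ∀ {X} {ρ : X → Carrier A} r →
                     Holds B (fun h ∘ ρ) r → Holds A ρ r
    reflects-Holds inj (s , t) p =
      inj (B.trans (eval-hom _ s) (B.trans p (B.sym (eval-hom _ t))))

    reflects-∈ᵛ : Injective → ∀ {e} (W : Variety S e) → B ∈ᵛ W → A ∈ᵛ W
    reflects-∈ᵛ inj W B∈W s t p ρ = reflects-Holds inj (s , t) (B∈W s t p (fun h ∘ ρ))

    module Inverse (inj : Injective) (sur : Surjective h) where

      inverse : Hom B A
      inverse = record
        { fun  = λ y → proj₁ (sur y)
        ; cong = λ {x} {y} p → inj (B.trans (proj₂ (sur x)) (B.trans p (B.sym (proj₂ (sur y)))))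
        ; homo = λ f ys → inj (B.trans (proj₂ (sur _)) (B.trans
            (B.interp-cong f (λ i → B.sym (proj₂ (sur (ys i))))) (B.sym (Hom.homo h f _))))
        }

      inverseʳ : ∀ y → fun h (fun inverse y) B.≈ y
      inverseʳ y = proj₂ (sur y)

      inverseˡ : ∀ x → fun inverse (fun h x) A.≈ x
      inverseˡ x = inj (inverseʳ (fun h x))

  module _ (A : Algebra S) {X : Set} (a : X → Carrier A) where

    private module A = Algebra A

    -- The elements are terms compared by their values in `A`, so the inclusion is injective by
    -- definition and each element carries the term that generates it.
    subalgebra : Algebra S
    subalgebra = record
      { setoid      = record
          { Carrier       = Term S X
          ; _≈_           = λ s t → eval A a s A.≈ eval A a t
          ; isEquivalence = record { refl = A.refl ; sym = A.sym ; trans = A.trans }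
          }
      ; interp      = op
      ; interp-cong = λ f p → A.interp-cong f p
      }

    inclusion : Hom subalgebra A
    inclusion = record { fun = eval A a ; cong = id ; homo = λ _ _ → A.refl }

  -- The universal property maps `A` into the subalgebra generated by `gens`. Followed by the
  -- inclusion, this map fixes the generators, so by uniqueness it is the identity, and the image of
  -- `x` is a term with value `x`.
  finitelyPresented⇒finitelyGenerated : ∀ {e} (W : Variety S e) {A : Algebra S} → A ∈ᵛ W →
    FinitelyPresented W A → FinitelyGenerated A
  finitelyPresented⇒finitelyGenerated W {A} A∈W fp =
      #gens , gens , λ x → fun h x , unique A A∈W (inclusion A gens ∘ʰ h) idʰ h-gens x
    where
    open FinitelyPresented fp
    lift = extend (subalgebra A gens)
      (reflects-∈ᵛ (inclusion A gens) id W A∈W) var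
      (All.map (λ {r} → reflects-Holds (inclusion A gens) id r) satisfied)
    h = proj₁ lift
    h-gens = proj₂ lift

  _[_] : ∀ {X Y} → Term S X → (X → Term S Y) → Term S Y
  var x   [ σ ] = σ x
  op f ts [ σ ] = op f (λ i → ts i [ σ ])

  eval-[] : ∀ {X Y} (A : Algebra S) (ρ : Y → Carrier A) (σ : X → Term S Y) t →
            Algebra._≈_ A (eval A ρ (t [ σ ])) (eval A (eval A ρ ∘ σ) t)
  eval-[] A ρ σ (var x)   = Algebra.refl A
  eval-[] A ρ σ (op f ts) = Algebra.interp-cong A f (λ i → eval-[] A ρ σ (ts i))

  -- Equality is derivability in equational logic: quantifying over all the
  -- algebras of W instead would not fit in Set.
  module Free (W : Variety S 0ℓ) (X : Set) where

    infix 4 _≈ᶠ_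

    data _≈ᶠ_ : Rel (Term S X) 0ℓ where
      refl  : ∀ {s} → s ≈ᶠ s
      sym   : ∀ {s t} → s ≈ᶠ t → t ≈ᶠ s
      trans : ∀ {s t u} → s ≈ᶠ t → t ≈ᶠ u → s ≈ᶠ u
      cong  : ∀ {n} (f : S n) {ss ts} → (∀ i → ss i ≈ᶠ ts i) → op f ss ≈ᶠ op f ts
      axiom : ∀ {s t} → W s t → ∀ σ → s [ σ ] ≈ᶠ t [ σ ]

    free : Algebra S
    free = record
      { setoid      = record
          { Carrier = Term S X ; _≈_ = _≈ᶠ_
          ; isEquivalence = record { refl = refl ; sym = sym ; trans = trans } }
      ; interp      = op
      ; interp-cong = cong
      }

    eval-free : ∀ {Y : Set} (σ : Y → Term S X) t → eval free σ t ≈ᶠ t [ σ ]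
    eval-free σ (var x)   = refl
    eval-free σ (op f ts) = cong f (λ i → eval-free σ (ts i))

    free∈W : free ∈ᵛ W
    free∈W s t p σ = trans (eval-free σ s) (trans (axiom p σ) (sym (eval-free σ t)))

    module _ (C : Algebra S) (C∈W : C ∈ᵛ W) (c : X → Carrier C) where

      private module C = Algebra C

      sound : ∀ {s t} → s ≈ᶠ t → eval C c s C.≈ eval C c t
      sound refl        = C.refl
      sound (sym p)     = C.sym (sound p)
      sound (trans p q) = C.trans (sound p) (sound q)
      sound (cong f p)  = C.interp-cong f (λ i → sound (p i))
      sound (axiom {s} {t} p σ) = C.trans (eval-[] C c σ s)
        (C.trans (C∈W s t p (eval C c ∘ σ)) (C.sym (eval-[] C c σ t)))

      freeHom : Hom free C
      freeHom = record { fun = eval C c ; cong = sound ; homo = λ _ _ → C.refl }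

-- Order, open elements and the Grzegorczyk inequality in an interior algebra.

module InteriorProperties (A : Algebra InteriorSignature) (isInterior : IsInterior A) where

  open InteriorOperations A
  open IsInterior isInterior

  booleanAlgebra : Alg.BooleanAlgebra 0ℓ 0ℓ
  booleanAlgebra = record { isBooleanAlgebra = isBooleanAlgebra }

  private
    module FP = BooleanProperties booleanAlgebra
  module F = Alg.BooleanAlgebra booleanAlgebra
  module ≤ = Ord.Lattice (LatticeProperties.∨-∧-orderTheoreticLattice F.lattice)

  open ≤ public using (_≤_)
  open F public using () renaming (∨-cong to +-cong; ∧-cong to ·-cong; ¬-cong to -‿cong)

  g-cong : ∀ {x y} → x ≈ y → g x ≈ g y
  g-cong p = interp-cong gˢ λ where 0F → p

  inˡ : ∀ {x y} → x ≤ x + y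
  inˡ = ≤.x≤x∨y _ _

  inʳ : ∀ {x y} → y ≤ x + y
  inʳ = ≤.y≤x∨y _ _

  prˡ : ∀ {x y} → x · y ≤ x
  prˡ = ≤.x∧y≤x _ _

  prʳ : ∀ {x y} → x · y ≤ y
  prʳ = ≤.x∧y≤y _ _

  𝟘≤ : ∀ {x} → 𝟘 ≤ x
  𝟘≤ = F.sym (FP.∧-zeroˡ _)

  ≤𝟙 : ∀ {x} → x ≤ 𝟙
  ≤𝟙 = F.sym (FP.∧-identityʳ _)

  case : ∀ {w x y z} → w ≤ x + y → w · x ≤ z → w · y ≤ z → w ≤ z
  case p q r = ≤.trans (≤.∧-greatest ≤.refl p)
    (≤.trans (≤.reflexive (F.∧-distribˡ-∨ _ _ _)) (≤.∨-least q r))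

  em : ∀ {w} x {z} → w · x ≤ z → w · - x ≤ z → w ≤ z
  em x = case (≤.trans ≤𝟙 (≤.reflexive (F.sym (F.∨-complementʳ x))))

  contradict : ∀ {w x z} → w ≤ x → w ≤ - x → w ≤ z
  contradict p q = ≤.trans (≤.∧-greatest p q)
    (≤.trans (≤.reflexive (F.∧-complementʳ _)) 𝟘≤)

  residuate : ∀ {x y z} → x · y ≤ z → x ≤ - y + z
  residuate {y = y} p = em y (≤.trans p inʳ) (≤.trans prʳ inˡ)

  modus-ponens : ∀ {w x y} → w ≤ - x + y → w ≤ x → w ≤ y
  modus-ponens p q = case p (contradict (≤.trans prˡ q) prʳ) prʳ

  -‿antitone : ∀ {x y} → x ≤ y → - y ≤ - x
  -‿antitone {x} p = em x (contradict (≤.trans prʳ p) prˡ) prʳ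

  +-mono : ∀ {w x y z} → w ≤ x → y ≤ z → w + y ≤ x + z
  +-mono p q = ≤.∨-least (≤.trans p inˡ) (≤.trans q inʳ)

  g-deflationary : ∀ {x} → g x ≤ x
  g-deflationary = F.sym (g-≤ _)

  g-mono : ∀ {x y} → x ≤ y → g x ≤ g y
  g-mono p = F.trans (g-cong p) (g-· _ _)

  Open : Carrier → Set
  Open x = x ≤ g x

  g-open : ∀ {x} → Open (g x)
  g-open = ≤.reflexive (F.sym (g-g _))

  open-≈ : ∀ {x} → Open x → g x ≈ x
  open-≈ p = ≤.antisym g-deflationary p

  g-greatest : ∀ {x y} → Open x → x ≤ y → x ≤ g y
  g-greatest p q = ≤.trans p (g-mono q)

  +-open : ∀ {x y} → Open x → Open y → Open (x + y)
  +-open p q = ≤.∨-least (g-greatest p inˡ) (g-greatest q inʳ)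

  ·-open : ∀ {x y} → Open x → Open y → Open (x · y)
  ·-open p q = ≤.trans (≤.∧-greatest (≤.trans prˡ p) (≤.trans prʳ q)) (≤.reflexive (F.sym (g-· _ _)))

  𝟘-open : Open 𝟘
  𝟘-open = 𝟘≤

  𝟙-open : Open 𝟙
  𝟙-open = ≤.reflexive (F.sym g-𝟙)

  infix 5 _↔_

  -- The biconditional turns an equation into the statement that a single element is `𝟙`, to which
  -- `g` can be applied.
  _↔_ : Carrier → Carrier → Carrier
  x ↔ y = (- x + y) · (- y + x)

  ≈⇒↔ : ∀ {x y} → x ≈ y → 𝟙 ≤ x ↔ y
  ≈⇒↔ p = ≤.∧-greatest (residuate (≤.trans prʳ (≤.reflexive p)))
                       (residuate (≤.trans prʳ (≤.reflexive (F.sym p))))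

  ↔⇒≈ : ∀ {x y} → 𝟙 ≤ x ↔ y → x ≈ y
  ↔⇒≈ p = ≤.antisym (modus-ponens (≤.trans ≤𝟙 (≤.trans p prˡ)) ≤.refl)
                    (modus-ponens (≤.trans ≤𝟙 (≤.trans p prʳ)) ≤.refl)

  -- If every open o ≤ c on which x, or its complement, holds up to a already
  -- lies below a, then c ≤ a.  Ranging over c and a makes the property
  -- inherited by Boolean combinations of opens.
  Scattered : Carrier → Set
  Scattered x = ∀ {c a} → Open c → Open a →
    (∀ {o} → Open o → o ≤ c → o ≤ x + a → o ≤ a) →
    (∀ {o} → Open o → o ≤ c → o ≤ - x + a → o ≤ a) → c ≤ a

  scattered-𝟙 : Scattered 𝟙
  scattered-𝟙 oc oa p q = p oc ≤.refl (≤.trans ≤𝟙 inˡ)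

  -- Below `c · v` the clause is true, so scatteredness of `x` gives `c · v ≤ a`. On `c · u` the
  -- clause forces `v`, so the product fails there up to `a` and the second hypothesis gives
  -- `c · u ≤ a`. Hence `- u + a` holds on all of `c`: the clause is true up to `a`, and
  -- scatteredness of `x` applies once more.
  scattered-clause : ∀ {u v x} → Open u → Open v → Scattered x → Scattered ((- u + v) · x)
  scattered-clause {u} {v} {x} ou ov sx {c} {a} oc oa p q =
      sx oc oa
        (λ oo o≤c r → p oo o≤c (case r
          (case (≤.trans prˡ (≤.trans o≤c (residuate cu≤a)))
            (≤.trans (≤.∧-greatest (≤.trans prʳ inˡ) (≤.trans prˡ prʳ)) inˡ)
            (≤.trans prʳ inʳ))
          (≤.trans prʳ inʳ)))
        (λ oo o≤c r → q oo o≤c (≤.trans r (+-mono (-‿antitone prʳ) ≤.refl)))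
    where
    cv≤a : c · v ≤ a
    cv≤a = sx (·-open oc ov) oa
      (λ oo o≤cv r → p oo (≤.trans o≤cv prˡ) (case r
        (≤.trans (≤.∧-greatest (≤.trans prˡ (≤.trans o≤cv (≤.trans prʳ inʳ))) prʳ) inˡ)
        (≤.trans prʳ inʳ)))
      (λ oo o≤cv r → q oo (≤.trans o≤cv prˡ) (≤.trans r (+-mono (-‿antitone prʳ) ≤.refl)))
    cu≤a : c · u ≤ a
    cu≤a = q (·-open oc ou) prˡ (residuate (≤.trans
      (≤.∧-greatest (≤.trans prˡ prˡ)
        (modus-ponens (≤.trans prʳ prˡ) (≤.trans prˡ prʳ)))
      cv≤a))

  -- Grzegorczyk's modal axiom with `g` as necessity and `- a + b` as the implication from `a` to
  -- `b`.
  Grz : Carrier → Set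
  Grz x = g (- g (- x + g x) + x) ≤ x

  -- Scatteredness is used with the left side of `Grz x` as `c` and `g x` as `a`. An open
  -- `o ≤ x + g x` is below `x`, hence below `g x`. An open `o ≤ - x + g x` is below
  -- `g (- x + g x)`, so `o ≤ c` forces `o ≤ x`.
  scattered⇒Grz : ∀ {x} → Scattered x → Grz x
  scattered⇒Grz sx = ≤.trans
    (sx g-open g-open
      (λ oo o≤c r → g-greatest oo (≤.trans r (≤.∨-least ≤.refl g-deflationary)))
      (λ oo o≤c r → g-greatest oo
        (modus-ponens (≤.trans o≤c g-deflationary) (g-greatest oo r))))
    g-deflationary

  module Alternation (x : Carrier) where

    -- For open `a`, `half a` adds to `a` a layer inside `x`, and `step a` adds to `half a` a layer
    -- inside `- x`; each is the largest open that does so.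
    half step : Carrier → Carrier
    half a = g (x + a)
    step a = g (- x + half a)

    ≤-half : ∀ {a} → Open a → a ≤ half a
    ≤-half oa = g-greatest oa inʳ

    half≤step : ∀ {a} → half a ≤ step a
    half≤step = g-greatest g-open inʳ

    -- Of the two layers added to `a`, only `half a · - a` meets `x`, and it lies inside `x`. This
    -- expresses `x · step a` through `x · a` and opens.
    ·-step : ∀ {a} → Open a → x · step a ≈ x · a + half a · - a
    ·-step {a} oa = ≤.antisym
      (em a
        (≤.trans (≤.∧-greatest (≤.trans prˡ prˡ) prʳ) inˡ)
        (≤.trans (≤.∧-greatest
          (≤.trans prˡ (modus-ponens (≤.trans prʳ g-deflationary) prˡ)) prʳ) inʳ))
      (≤.∨-least
        (≤.∧-greatest prˡ (≤.trans prʳ (≤.trans (≤-half oa) half≤step)))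
        (≤.∧-greatest
          (case (≤.trans prˡ g-deflationary) prʳ (contradict prʳ (≤.trans prˡ prʳ)))
          (≤.trans prˡ half≤step)))

    -- Let `y` be `x + a`, so that `g y` is `half a`. If `step a ≤ a`, then
    -- `g (- y + g y) ≤ step a ≤ a ≤ y`, so the left side of `Grz y` is `𝟙`. Thus `y` is `𝟙`, and so
    -- is its interior `half a`, which is below `a`.
    step-fixed : ∀ {a} → Grz (x + a) → Open a → step a ≤ a → 𝟙 ≤ a
    step-fixed {a} grz oa p =
        ≤.trans 𝟙-open (≤.trans (g-mono (≤.trans
          (≤.trans 𝟙-open (g-mono (residuate (≤.trans prʳ (≤.trans inner inʳ))))) grz)) half≤a)
      where
      half≤a : half a ≤ a
      half≤a = ≤.trans half≤step p
      inner : g (- (x + a) + half a) ≤ a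
      inner = ≤.trans (g-mono (+-mono (-‿antitone inˡ) ≤.refl)) p

    iterate : ℕ → Carrier
    iterate zero    = 𝟘
    iterate (suc k) = step (iterate k)

    iterate-open : ∀ k → Open (iterate k)
    iterate-open zero    = 𝟘-open
    iterate-open (suc k) = g-open

    iterate-suc : ∀ k → iterate k ≤ iterate (suc k)
    iterate-suc k = ≤.trans (≤-half (iterate-open k)) half≤step

    iterate-mono : ∀ {j k} → j ℕ.≤′ k → iterate j ≤ iterate k
    iterate-mono (ℕ.≤′-reflexive ≡.refl) = ≤.refl
    iterate-mono (ℕ.≤′-step {k} p)       = ≤.trans (iterate-mono p) (iterate-suc k)

    -- Two of the first `n + 1` iterates receive the same index in the enumeration and so are equal.
    -- By monotonicity the step after the earlier one adds nothing.
    iterate-𝟙 : (∀ y → Grz y) → Finite A → ∃[ k ] (𝟙 ≤ iterate k)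
    iterate-𝟙 grz (n , e , sur) with pigeonhole (n<1+n n) (λ i → proj₁ (sur (iterate (toℕ i))))
    ... | i , j , i<j , eq = toℕ i , step-fixed (grz _) (iterate-open (toℕ i))
            (≤.trans (iterate-mono (≤⇒≤′ i<j)) (≤.reflexive j≈i))
      where
      j≈i : iterate (toℕ j) ≈ iterate (toℕ i)
      j≈i = F.trans (F.sym (proj₂ (sur _)))
        (F.trans (F.reflexive (≡.cong e (≡.sym eq))) (proj₂ (sur _)))

-- Homomorphisms of interior algebras and a criterion for surjectivity.

module InteriorHom {A B : Algebra InteriorSignature} (h : Hom A B) where

  private
    module A = InteriorOperations A
    module B = InteriorOperations B

  +-homo : ∀ x y → fun h (x A.+ y) B.≈ fun h x B.+ fun h y
  +-homo x y = B.trans (Hom.homo h +ˢ _) (interp-η₂ B +ˢ _)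

  ·-homo : ∀ x y → fun h (x A.· y) B.≈ fun h x B.· fun h y
  ·-homo x y = B.trans (Hom.homo h ·ˢ _) (interp-η₂ B ·ˢ _)

  -‿homo : ∀ x → fun h (A.- x) B.≈ B.- fun h x
  -‿homo x = B.trans (Hom.homo h -ˢ _) (interp-η₁ B -ˢ _)

  g-homo : ∀ x → fun h (A.g x) B.≈ B.g (fun h x)
  g-homo x = B.trans (Hom.homo h gˢ _) (interp-η₁ B gˢ _)

  𝟙-homo : fun h A.𝟙 B.≈ B.𝟙
  𝟙-homo = B.trans (Hom.homo h 𝟙ˢ _) (interp-η₀ B 𝟙ˢ _)

  𝟘-homo : fun h A.𝟘 B.≈ B.𝟘
  𝟘-homo = B.trans (Hom.homo h 𝟘ˢ _) (interp-η₀ B 𝟘ˢ _)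

  module _ (I : IsInterior B) where

    open InteriorProperties B I

    private
      Image : B.Carrier → Set
      Image y = ∃[ x ] (fun h x B.≈ y)

    -- The image is closed under the operations and contains all opens, so by `·-step` it contains
    -- every `y · iterate k`. Once `iterate k` is `𝟙`, this product is `y`.
    open-surjective⇒surjective : (∀ y → Grz y) → Finite B →
      (∀ y → Image (B.g y)) → Surjective h
    open-surjective⇒surjective grz fin image-g y =
        let k , 𝟙≤ = iterate-𝟙 grz fin
            x , p  = image-· k
        in x , B.trans p (≤.antisym prˡ (≤.∧-greatest ≤.refl (≤.trans ≤𝟙 𝟙≤)))
      where
      open Alternation y
      image-iterate : ∀ k → Image (iterate k)
      image-iterate zero    = A.𝟘 , 𝟘-homo
      image-iterate (suc k) = image-g _
      image-· : ∀ k → Image (y B.· iterate k)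
      image-· zero    = A.𝟘 , B.trans 𝟘-homo (≤.antisym 𝟘≤ prʳ)
      image-· (suc k) =
        let u , p = image-· k
            v , q = image-g (y B.+ iterate k)
            w , r = image-iterate k
        in u A.+ v A.· (A.- w) , B.trans (+-homo _ _) (B.trans
             (+-cong p (B.trans (·-homo _ _) (·-cong q (B.trans (-‿homo _) (-‿cong r)))))
             (B.sym (·-step (iterate-open k))))

-- Interior terms, the Gödel translation and the Heyting algebra of open elements.

infixl 6 _+ᵗ_
infixl 7 _·ᵗ_
infix  8 -ᵗ_

_+ᵗ_ _·ᵗ_ : ∀ {X} → Term InteriorSignature X → Term InteriorSignature X → Term InteriorSignature X
s +ᵗ t = op +ˢ (s V.∷ t V.∷ V.[])
s ·ᵗ t = op ·ˢ (s V.∷ t V.∷ V.[])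

-ᵗ_ gᵗ : ∀ {X} → Term InteriorSignature X → Term InteriorSignature X
-ᵗ t = op -ˢ (t V.∷ V.[])
gᵗ t = op gˢ (t V.∷ V.[])

𝟙ᵗ 𝟘ᵗ : ∀ {X} → Term InteriorSignature X
𝟙ᵗ = op 𝟙ˢ V.[]
𝟘ᵗ = op 𝟘ˢ V.[]

-- Vectors are functions without η on Fin, so eval ρ (s +ᵗ t) is not
-- definitionally eval ρ s + eval ρ t; eval′ makes such equations hold by refl.
module _ (A : Algebra InteriorSignature) where

  open InteriorOperations A

  eval′ : ∀ {X} → (X → Carrier) → Term InteriorSignature X → Carrier
  eval′ ρ (var x)    = ρ x
  eval′ ρ (op +ˢ ts) = eval′ ρ (ts 0F) + eval′ ρ (ts 1F)
  eval′ ρ (op ·ˢ ts) = eval′ ρ (ts 0F) · eval′ ρ (ts 1F)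
  eval′ ρ (op -ˢ ts) = - eval′ ρ (ts 0F)
  eval′ ρ (op gˢ ts) = g (eval′ ρ (ts 0F))
  eval′ ρ (op 𝟙ˢ ts) = 𝟙
  eval′ ρ (op 𝟘ˢ ts) = 𝟘

  eval≈eval′ : ∀ {X} (ρ : X → Carrier) t → eval ρ t ≈ eval′ ρ t
  eval≈eval′ ρ (var x)    = refl
  eval≈eval′ ρ (op +ˢ ts) = interp-cong +ˢ λ where
    0F → eval≈eval′ ρ (ts 0F)
    1F → eval≈eval′ ρ (ts 1F)
  eval≈eval′ ρ (op ·ˢ ts) = interp-cong ·ˢ λ where
    0F → eval≈eval′ ρ (ts 0F)
    1F → eval≈eval′ ρ (ts 1F)
  eval≈eval′ ρ (op -ˢ ts) = interp-cong -ˢ λ where 0F → eval≈eval′ ρ (ts 0F)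
  eval≈eval′ ρ (op gˢ ts) = interp-cong gˢ λ where 0F → eval≈eval′ ρ (ts 0F)
  eval≈eval′ ρ (op 𝟙ˢ ts) = interp-η₀ A 𝟙ˢ _
  eval≈eval′ ρ (op 𝟘ˢ ts) = interp-η₀ A 𝟘ˢ _

grzᵗ : Term InteriorSignature ℕ
grzᵗ = gᵗ (-ᵗ gᵗ (-ᵗ var 0 +ᵗ gᵗ (var 0)) +ᵗ var 0)

-- The order unfolds to an equation with a meet, so the Grzegorczyk inequality is an identity and
-- passes to generated varieties.
Grz⇒Holds : ∀ A (I : IsInterior A) ρ → InteriorProperties.Grz A I (ρ 0) →
            Holds A ρ (grzᵗ , grzᵗ ·ᵗ var 0)
Grz⇒Holds A I ρ p = trans (eval≈eval′ A ρ grzᵗ)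
    (trans p (sym (eval≈eval′ A ρ (grzᵗ ·ᵗ var 0))))
  where open Algebra A

-- The Gödel translation. With `gᵗ` on variables and implications, all values are open.
T : ∀ {X} → Term HeytingSignature X → Term InteriorSignature X
T (var x)    = gᵗ (var x)
T (op ∨ˢ ts) = T (ts 0F) +ᵗ T (ts 1F)
T (op ∧ˢ ts) = T (ts 0F) ·ᵗ T (ts 1F)
T (op ⇒ˢ ts) = gᵗ (-ᵗ T (ts 0F) +ᵗ T (ts 1F))
T (op ⊤ˢ ts) = 𝟙ᵗ
T (op ⊥ˢ ts) = 𝟘ᵗ

-- An arbitrary x stands for the open element g x.
module _ (A : Algebra InteriorSignature) (I : IsInterior A) where

  open InteriorOperations A
  open InteriorProperties A I

  opens : Algebra HeytingSignature
  opens = record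
    { setoid      = record
        { Carrier       = Carrier
        ; _≈_           = λ x y → g x ≈ g y
        ; isEquivalence = record { refl = refl ; sym = sym ; trans = trans }
        }
    ; interp      = λ where
        ∨ˢ xs → g (xs 0F) + g (xs 1F)
        ∧ˢ xs → g (xs 0F) · g (xs 1F)
        ⇒ˢ xs → - g (xs 0F) + g (xs 1F)
        ⊤ˢ xs → 𝟙
        ⊥ˢ xs → 𝟘
    ; interp-cong = λ where
        ∨ˢ p → g-cong (+-cong (p 0F) (p 1F))
        ∧ˢ p → g-cong (·-cong (p 0F) (p 1F))
        ⇒ˢ p → g-cong (+-cong (-‿cong (p 0F)) (p 1F))
        ⊤ˢ p → refl
        ⊥ˢ p → refl
    }

  eval′-T : ∀ {X} (ρ : X → Carrier) t →
            eval′ A ρ (T t) ≈ g (Algebra.eval opens ρ t)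
  eval′-T ρ (var x)    = refl
  eval′-T ρ (op ∨ˢ ts) = trans (+-cong (eval′-T ρ (ts 0F)) (eval′-T ρ (ts 1F)))
    (sym (open-≈ (+-open g-open g-open)))
  eval′-T ρ (op ∧ˢ ts) = trans (·-cong (eval′-T ρ (ts 0F)) (eval′-T ρ (ts 1F)))
    (sym (open-≈ (·-open g-open g-open)))
  eval′-T ρ (op ⇒ˢ ts) =
    g-cong (+-cong (-‿cong (eval′-T ρ (ts 0F))) (eval′-T ρ (ts 1F)))
  eval′-T ρ (op ⊤ˢ ts) = sym (open-≈ 𝟙-open)
  eval′-T ρ (op ⊥ˢ ts) = sym (open-≈ 𝟘-open)

  Holds-T : ∀ {X} (ρ : X → Carrier) s t → Holds A ρ (T s , T t) → Holds opens ρ (s , t)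
  Holds-T ρ s t p = trans (sym (eval′-T ρ s)) (trans (sym (eval≈eval′ A ρ (T s)))
    (trans p (trans (eval≈eval′ A ρ (T t)) (eval′-T ρ t))))

module _ {A B : Algebra InteriorSignature} (I : IsInterior A) (J : IsInterior B) where

  private
    module A = InteriorOperations A
    module B = InteriorOperations B
    module BP = InteriorProperties B J

  opensHom : Hom A B → Hom (opens A I) (opens B J)
  opensHom h = record
    { fun  = fun h
    ; cong = λ p → B.trans (B.sym (g-homo _)) (B.trans (Hom.cong h p) (g-homo _))
    ; homo = λ where
        ∨ˢ xs → BP.g-cong (B.trans (+-homo _ _) (BP.+-cong (g-homo _) (g-homo _)))
        ∧ˢ xs → BP.g-cong (B.trans (·-homo _ _) (BP.·-cong (g-homo _) (g-homo _)))
        ⇒ˢ xs → BP.g-cong (B.trans (+-homo _ _)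
                  (BP.+-cong (B.trans (-‿homo _) (BP.-‿cong (g-homo _))) (g-homo _)))
        ⊤ˢ xs → BP.g-cong 𝟙-homo
        ⊥ˢ xs → BP.g-cong 𝟘-homo
    }
    where open InteriorHom h

-- The free Boolean extension: its opens and its universal property.

module 𝓑Properties (L : Algebra HeytingSignature) (isHeyting : IsHeyting L) where

  open FreeBooleanExtension (heytingAlgebra L isHeyting) public
    renaming (𝓑 to ℬ; 𝓑-isInterior to ℬ-isInterior)

  private
    module L = Algebra L
    module H = HeytingOperations L
    module FB = InteriorProperties ℬ ℬ-isInterior

  ι-injective : ∀ {a b} → ι a ≃ ι b → a L.≈ b
  ι-injective p = HA.antisym (ι-reflects-≤ (FB.≤.reflexive p))
                             (ι-reflects-≤ (FB.≤.reflexive (≃-sym p)))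
    where module HA = Ord.HeytingAlgebra (heytingAlgebra L isHeyting)

  gᴸ-cong : ∀ {x y} → x ≃ y → gᴸ x L.≈ gᴸ y
  gᴸ-cong p = ι-injective (g-cong p)

  g-ι : ∀ a → g (ι a) ≃ ι a
  g-ι a = FB.≤.antisym FB.g-deflationary
    (ι-mono (g← (ι a) FB.≤.refl))

  ι-⇒ : ∀ a b → ι (a H.⇒ b) ≃ g (- ι a + ι b)
  ι-⇒ a b = begin
    ι (a H.⇒ b)              ≈⟨ ι-∧⊤ ⟨
    ι ((a H.⇒ b) H.∧ H.⊤)    ≈⟨ g-formula ((a , b) ∷ []) ⟨
    g ((- ι a + ι b) · 𝟙)    ≈⟨ g-cong (·𝟙 (- ι a + ι b)) ⟩
    g (- ι a + ι b)          ∎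
    where
    open SetoidReasoning (Algebra.setoid ℬ)
    ·𝟙 : ∀ x → x · 𝟙 ≃ x
    ·𝟙 x = ≃-sym FB.≤𝟙
    ι-∧⊤ : ι ((a H.⇒ b) H.∧ H.⊤) ≃ ι (a H.⇒ b)
    ι-∧⊤ = ≃-trans (ι-∧ _ _) (≃-trans (·-congʳ ι-⊤) (·𝟙 _))

  scattered-∏ : ∀ cs → FB.Scattered (∏ cs)
  scattered-∏ []             = FB.scattered-𝟙
  scattered-∏ ((u , v) ∷ cs) =
    FB.scattered-clause (FB.≤.reflexive (≃-sym (g-ι u))) (FB.≤.reflexive (≃-sym (g-ι v)))
      (scattered-∏ cs)

  -- Every element is a product of clauses formed from opens, and such products are scattered.
  Fr-Grz : ∀ x → FB.Grz x
  Fr-Grz x = FB.≤.trans (FB.≤.reflexive (g-cong (+-cong (-‿cong (g-cong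
      (+-cong (-‿cong x≃) (g-cong x≃)))) x≃)))
    (FB.≤.trans (FB.scattered⇒Grz (scattered-∏ (normalForm x)))
      (FB.≤.reflexive (normalForm-correct x)))
    where
    x≃ : x ≃ ∏ (normalForm x)
    x≃ = ≃-sym (normalForm-correct x)

  -- An identity of `L` thereby yields its translation in `ℬ L`. This is how identities of V reach
  -- the opens of every algebra in ρ*(V).
  eval-T : ∀ {X} (ρ : X → Fr) t →
           Algebra.eval ℬ ρ (T t) ≃ ι (L.eval (gᴸ ∘ ρ) t)
  eval-T ρ (var x)    = ≃-refl
  eval-T ρ (op ∨ˢ ts) = ≃-trans (+-cong (eval-T ρ (ts 0F)) (eval-T ρ (ts 1F)))
    (≃-trans (≃-sym (ι-∨ _ _)) (ι-cong (L.sym (interp-η₂ L ∨ˢ _))))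
  eval-T ρ (op ∧ˢ ts) = ≃-trans (·-cong (eval-T ρ (ts 0F)) (eval-T ρ (ts 1F)))
    (≃-trans (≃-sym (ι-∧ _ _)) (ι-cong (L.sym (interp-η₂ L ∧ˢ _))))
  eval-T ρ (op ⇒ˢ ts) =
    ≃-trans (g-cong (+-cong (-‿cong (eval-T ρ (ts 0F))) (eval-T ρ (ts 1F))))
    (≃-trans (≃-sym (ι-⇒ _ _)) (ι-cong (L.sym (interp-η₂ L ⇒ˢ _))))
  eval-T ρ (op ⊤ˢ ts) = ≃-trans (≃-sym ι-⊤) (ι-cong (L.sym (interp-η₀ L ⊤ˢ _)))
  eval-T ρ (op ⊥ˢ ts) = ≃-trans (≃-sym ι-⊥) (ι-cong (L.sym (interp-η₀ L ⊥ˢ _)))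

  module _ (I : IsInterior ℬ) where

    -- The unit of the adjunction. `I` is arbitrary because membership in ρ*(V) supplies its own
    -- proof that `ℬ` is an interior algebra.
    ιʰ : Hom L (opens ℬ I)
    ιʰ = record
      { fun  = ι
      ; cong = λ p → g-cong (ι-cong p)
      ; homo = λ where
          ∨ˢ xs → g-cong (≃-trans (ι-cong (interp-η₂ L ∨ˢ _))
                    (≃-trans (ι-∨ _ _) (+-cong (≃-sym (g-ι _)) (≃-sym (g-ι _)))))
          ∧ˢ xs → g-cong (≃-trans (ι-cong (interp-η₂ L ∧ˢ _))
                    (≃-trans (ι-∧ _ _) (·-cong (≃-sym (g-ι _)) (≃-sym (g-ι _)))))
          ⇒ˢ xs → ≃-trans (g-ι _) (≃-trans (ι-cong (interp-η₂ L ⇒ˢ _)) (≃-trans (ι-⇒ _ _)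
                    (g-cong (+-cong (-‿cong (≃-sym (g-ι _))) (≃-sym (g-ι _))))))
          ⊤ˢ xs → g-cong (≃-trans (ι-cong (interp-η₀ L ⊤ˢ _)) ι-⊤)
          ⊥ˢ xs → g-cong (≃-trans (ι-cong (interp-η₀ L ⊥ˢ _)) ι-⊥)
      }

    ιʰ-injective : Injective ιʰ
    ιʰ-injective p = ι-injective (≃-trans (≃-sym (g-ι _)) (≃-trans p (g-ι _)))

    ιʰ-surjective : Surjective ιʰ
    ιʰ-surjective x = gᴸ x , g-ι (gᴸ x)

    open Inverse ιʰ ιʰ-injective ιʰ-surjective public using ()
      renaming (inverse to gᴸʰ; inverseˡ to gᴸ-ι)

  -- The Boolean operations alone generate `ℬ` from the elements `ι a`, so the induction has no case
  -- for `g`.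
  Hom-≈ : ∀ {A} {h k : Hom ℬ A} → IsInterior A →
          (∀ a → Algebra._≈_ A (fun h (ι a)) (fun k (ι a))) →
          ∀ x → Algebra._≈_ A (fun h x) (fun k x)
  Hom-≈ {A} {h} {k} I p = go
    where
    open Algebra A
    open InteriorProperties A I using () renaming
      (+-cong to +ᴬ-cong; ·-cong to ·ᴬ-cong; -‿cong to -ᴬ-cong)
    module h = InteriorHom h
    module k = InteriorHom k
    go : ∀ x → fun h x ≈ fun k x
    go (ι a)   = p a
    go (x + y) = trans (h.+-homo x y) (trans (+ᴬ-cong (go x) (go y)) (sym (k.+-homo x y)))
    go (x · y) = trans (h.·-homo x y) (trans (·ᴬ-cong (go x) (go y)) (sym (k.·-homo x y)))
    go (- x)   = trans (h.-‿homo x) (trans (-ᴬ-cong (go x)) (sym (k.-‿homo x)))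
    go 𝟙       = trans h.𝟙-homo (sym k.𝟙-homo)
    go 𝟘       = trans h.𝟘-homo (sym k.𝟘-homo)

  module Transpose {A : Algebra InteriorSignature} (I : IsInterior A)
                   (f : Hom L (opens A I)) where

    private
      module A = InteriorOperations A
      open InteriorProperties A I hiding (module ≤; g-cong) renaming
        (+-cong to +ᴬ-cong; ·-cong to ·ᴬ-cong; -‿cong to -ᴬ-cong)
      module AP = InteriorProperties A I

    ⟦_⟧ : Fr → A.Carrier
    ⟦ ι a ⟧   = A.g (fun f a)
    ⟦ x + y ⟧ = ⟦ x ⟧ A.+ ⟦ y ⟧
    ⟦ x · y ⟧ = ⟦ x ⟧ A.· ⟦ y ⟧
    ⟦ - x ⟧   = A.- ⟦ x ⟧
    ⟦ 𝟙 ⟧     = A.𝟙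
    ⟦ 𝟘 ⟧     = A.𝟘

    ⟦⟧-cong : ∀ {x y} → x ≃ y → ⟦ x ⟧ A.≈ ⟦ y ⟧
    ⟦⟧-cong ≃-refl               = A.refl
    ⟦⟧-cong (≃-sym p)            = A.sym (⟦⟧-cong p)
    ⟦⟧-cong (≃-trans p q)        = A.trans (⟦⟧-cong p) (⟦⟧-cong q)
    ⟦⟧-cong (+-cong p q)         = +ᴬ-cong (⟦⟧-cong p) (⟦⟧-cong q)
    ⟦⟧-cong (·-cong p q)         = ·ᴬ-cong (⟦⟧-cong p) (⟦⟧-cong q)
    ⟦⟧-cong (-‿cong p)           = -ᴬ-cong (⟦⟧-cong p)
    ⟦⟧-cong (+-comm x y)         = F.∨-comm _ _
    ⟦⟧-cong (+-assoc x y z)      = F.∨-assoc _ _ _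
    ⟦⟧-cong (·-comm x y)         = F.∧-comm _ _
    ⟦⟧-cong (·-assoc x y z)      = F.∧-assoc _ _ _
    ⟦⟧-cong (+-absorbs-· x y)    = F.∨-absorbs-∧ _ _
    ⟦⟧-cong (·-absorbs-+ x y)    = F.∧-absorbs-∨ _ _
    ⟦⟧-cong (+-distribʳ-· x y z) = F.∨-distribʳ-∧ _ _ _
    ⟦⟧-cong (+-complement x)     = F.∨-complementʳ _
    ⟦⟧-cong (·-complement x)     = F.∧-complementʳ _
    ⟦⟧-cong (ι-cong p)           = Hom.cong f p
    ⟦⟧-cong (ι-∨ a b)            = A.trans (Hom.homo f ∨ˢ _) (open-≈ (+-open g-open g-open))
    ⟦⟧-cong (ι-∧ a b)            = A.trans (Hom.homo f ∧ˢ _) (open-≈ (·-open g-open g-open))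
    ⟦⟧-cong ι-⊤                  = A.trans (Hom.homo f ⊤ˢ _) (open-≈ 𝟙-open)
    ⟦⟧-cong ι-⊥                  = A.trans (Hom.homo f ⊥ˢ _) (open-≈ 𝟘-open)

    -- In the opens of `A` an implication is the interior of `- u + v`, and `g` distributes over
    -- products. Normal forms then make the Boolean extension of `f` commute with `g`.
    ⟦⟧-⋀⇒ : ∀ cs → ⟦ ι (⋀⇒ cs) ⟧ A.≈ A.g ⟦ ∏ cs ⟧
    ⟦⟧-⋀⇒ []             = Hom.homo f ⊤ˢ _
    ⟦⟧-⋀⇒ ((u , v) ∷ cs) = A.trans (⟦⟧-cong (ι-∧ _ _))
      (A.trans (·ᴬ-cong (Hom.homo f ⇒ˢ _) (⟦⟧-⋀⇒ cs)) (A.sym (IsInterior.g-· I _ _)))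

    ⟦⟧-g : ∀ x → ⟦ g x ⟧ A.≈ A.g ⟦ x ⟧
    ⟦⟧-g x = A.trans (⟦⟧-⋀⇒ (normalForm x)) (AP.g-cong (⟦⟧-cong (normalForm-correct x)))

    transpose : Hom ℬ A
    transpose = record
      { fun  = ⟦_⟧
      ; cong = ⟦⟧-cong
      ; homo = λ where
          +ˢ xs → A.sym (interp-η₂ A +ˢ _)
          ·ˢ xs → A.sym (interp-η₂ A ·ˢ _)
          -ˢ xs → A.sym (interp-η₁ A -ˢ _)
          gˢ xs → A.trans (⟦⟧-g (xs 0F)) (A.sym (interp-η₁ A gˢ _))
          𝟙ˢ xs → A.sym (interp-η₀ A 𝟙ˢ _)
          𝟘ˢ xs → A.sym (interp-η₀ A 𝟘ˢ _)
      }

    -- An equation holds when the biconditional of its sides is `𝟙`, equivalently when the interior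
    -- of that biconditional is. Since this interior comes from `L`, an equation between values of
    -- the extension becomes one between values of `f`; the next lemma is the converse.
    ⟦⟧-≈⇒gᴸ≈⊤ : ∀ x y → ⟦ x ⟧ A.≈ ⟦ y ⟧ → A.g (fun f (gᴸ (x FB.↔ y))) A.≈ A.g (fun f H.⊤)
    ⟦⟧-≈⇒gᴸ≈⊤ x y p = A.trans (⟦⟧-g (x FB.↔ y)) (A.trans
      (AP.g-cong (A.sym (AP.≤.antisym (≈⇒↔ p) ≤𝟙)))
      (A.trans (AP.open-≈ 𝟙-open) (⟦⟧-cong (≃-sym ι-⊤))))

    gᴸ≈⊤⇒⟦⟧-≈ : ∀ x y → A.g (fun f (gᴸ (x FB.↔ y))) A.≈ A.g (fun f H.⊤) → ⟦ x ⟧ A.≈ ⟦ y ⟧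
    gᴸ≈⊤⇒⟦⟧-≈ x y p = ↔⇒≈ (AP.≤.trans
      (AP.≤.reflexive (A.trans (⟦⟧-cong (≃-sym ι-⊤)) (A.trans (A.sym p) (⟦⟧-g (x FB.↔ y)))))
      g-deflationary)

    -- If `x` and `y` have equal images, then `f` identifies `gᴸ (x ↔ y)` with the top. Injectivity
    -- makes `g (x ↔ y)` equal to `𝟙`, and it lies below `x ↔ y`.
    transpose-injective : Injective f → Injective transpose
    transpose-injective inj {x} {y} p = FB.↔⇒≈ (FB.≤.trans
      (FB.≤.reflexive (≃-trans (≃-sym ι-⊤) (ι-cong (inj (A.sym (⟦⟧-≈⇒gᴸ≈⊤ x y p))))))
      FB.g-deflationary)

-- Equivalences of quasiorders.

-- The maps are inverse only up to mutual comparability. Dense antichains still transfer, with the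
-- same index type.
record QuasiorderEquivalence {a b} {P : Set a} {Q : Set b} (_≽_ : Rel P 0ℓ) (_⊒_ : Rel Q 0ℓ)
    : Set (a ⊔ b) where
  field
    ≽-trans   : ∀ {x y z} → x ≽ y → y ≽ z → x ≽ z
    ⊒-trans   : ∀ {x y z} → x ⊒ y → y ⊒ z → x ⊒ z
    to        : P → Q
    from      : Q → P
    to-mono   : ∀ {x y} → x ≽ y → to x ⊒ to y
    from-mono : ∀ {x y} → x ⊒ y → from x ≽ from y
    from-to-≽ : ∀ x → from (to x) ≽ x
    ≽-from-to : ∀ x → x ≽ from (to x)
    to-from-⊒ : ∀ y → to (from y) ⊒ y
    ⊒-to-from : ∀ y → y ⊒ to (from y)

  flip : QuasiorderEquivalence _⊒_ _≽_
  flip = record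
    { ≽-trans   = ⊒-trans
    ; ⊒-trans   = ≽-trans
    ; to        = from
    ; from      = to
    ; to-mono   = from-mono
    ; from-mono = to-mono
    ; from-to-≽ = to-from-⊒
    ; ≽-from-to = ⊒-to-from
    ; to-from-⊒ = from-to-≽
    ; ⊒-to-from = ≽-from-to
    }

  module _ {i} {Index : Set i} (member : Index → P) where

    to-antichain : (∀ i j → member i ≽ member j → i ≡ j) →
                   ∀ i j → to (member i) ⊒ to (member j) → i ≡ j
    to-antichain antichain i j p = antichain i j
      (≽-trans (≽-from-to _) (≽-trans (from-mono p) (from-to-≽ _)))

    to-dense : (∀ x → ∃[ i ] (member i ≽ x)) → ∀ y → ∃[ i ] (to (member i) ⊒ y)
    to-dense dense y =
      let i , p = dense (from y) in i , ⊒-trans (to-mono p) (to-from-⊒ y)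

module _ {S : Signature} {e} (W : Variety S e) {A : Algebra S} where

  open Unifier

  ≽-transitive : {u v w : Unifier W A} → _≽_ W u v → _≽_ W v w → _≽_ W u w
  ≽-transitive {w = w} (h , p) (k , q) =
    k ∘ʰ h , λ x → Algebra.trans (target w) (q x) (Hom.cong k (p x))

-- The adjunction between V and ρ*(V).

module Companion (V : HeytingVariety) where

  open HeytingVariety V renaming (variety to 𝕍)

  𝕎 : Variety InteriorSignature (lsuc 0ℓ)
  𝕎 = ρ* V

  𝕍-Algebra : Set₁
  𝕍-Algebra = ∃[ L ] (L ∈ᵛ 𝕍)

  𝕎-Algebra : Set₁
  𝕎-Algebra = ∃[ A ] (A ∈ᵛ 𝕎)

  module 𝔅 (L : 𝕍-Algebra) = 𝓑Properties (proj₁ L) (heyting (proj₁ L) (proj₂ L))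

  B : 𝕍-Algebra → 𝕎-Algebra
  B L = 𝔅.ℬ L , λ s t p → p L

  -- An identity of all generating algebras holds in `A`; through `eval′` it reduces to the law in
  -- its usual form.
  law : ∀ ((A , _) : 𝕎-Algebra) s t → (∀ L ρ → Holds (𝔅.ℬ L) ρ (s , t)) →
        ∀ ρ → Algebra._≈_ A (eval′ A ρ s) (eval′ A ρ t)
  law (A , A∈𝕎) s t p ρ = A.trans (A.sym (eval≈eval′ A ρ s))
    (A.trans (A∈𝕎 s t p ρ) (eval≈eval′ A ρ t))
    where module A = Algebra A

  module _ (𝐀 : 𝕎-Algebra) where

    private A = proj₁ 𝐀

    open InteriorOperations A

    private
      env : Carrier → Carrier → Carrier → ℕ → Carrier
      env x y z 0             = x
      env x y z 1             = y
      -- The value of the third variable is also the default for all later ones.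
      env x y z (suc (suc _)) = z

      X Y Z : Term InteriorSignature ℕ
      X = var 0
      Y = var 1
      Z = var 2

      law₁ : ∀ s t → _ → ∀ x → _
      law₁ s t p x = law 𝐀 s t p (env x x x)

      law₂ : ∀ s t → _ → ∀ x y → _
      law₂ s t p x y = law 𝐀 s t p (env x y y)

      law₃ : ∀ s t → _ → ∀ x y z → _
      law₃ s t p x y z = law 𝐀 s t p (env x y z)

    abstract

      isInterior : IsInterior A
      isInterior = record
        { isBooleanAlgebra = Biased.isBooleanAlgebraʳ record
            { isDistributiveLattice = Biased.isDistributiveLatticeʳʲᵐ record
              { isLattice = record
                { isEquivalence = isEquivalence
                ; ∨-comm        = law₂ (X +ᵗ Y) (Y +ᵗ X) λ L ρ → 𝔅.+-comm _ _
                ; ∨-assoc       = law₃ ((X +ᵗ Y) +ᵗ Z) (X +ᵗ (Y +ᵗ Z)) λ L ρ → 𝔅.+-assoc _ _ _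
                ; ∨-cong        = λ p q → interp-cong +ˢ λ where
                                    0F → p
                                    1F → q
                ; ∧-comm        = law₂ (X ·ᵗ Y) (Y ·ᵗ X) λ L ρ → 𝔅.·-comm _ _
                ; ∧-assoc       = law₃ ((X ·ᵗ Y) ·ᵗ Z) (X ·ᵗ (Y ·ᵗ Z)) λ L ρ → 𝔅.·-assoc _ _ _
                ; ∧-cong        = λ p q → interp-cong ·ˢ λ where
                                    0F → p
                                    1F → q
                ; absorptive    =
                    law₂ (X +ᵗ X ·ᵗ Y) X (λ L ρ → 𝔅.+-absorbs-· _ _) ,
                    law₂ (X ·ᵗ (X +ᵗ Y)) X (λ L ρ → 𝔅.·-absorbs-+ _ _)
                }
              ; ∨-distribʳ-∧ = law₃ (Y ·ᵗ Z +ᵗ X) ((Y +ᵗ X) ·ᵗ (Z +ᵗ X)) λ L ρ → 𝔅.+-distribʳ-· _ _ _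
              }
            ; ∨-complementʳ = law₁ (X +ᵗ -ᵗ X) 𝟙ᵗ λ L ρ → 𝔅.+-complement _
            ; ∧-complementʳ = law₁ (X ·ᵗ -ᵗ X) 𝟘ᵗ λ L ρ → 𝔅.·-complement _
            ; ¬-cong        = λ p → interp-cong -ˢ λ where 0F → p
            }
        -- This identity is closed, so the assignment is arbitrary.
        ; g-𝟙 = law 𝐀 (gᵗ 𝟙ᵗ) 𝟙ᵗ (λ L ρ → IsInterior.g-𝟙 (𝔅.ℬ-isInterior L)) (λ _ → 𝟙)
        ; g-· = law₂ (gᵗ (X ·ᵗ Y)) (gᵗ X ·ᵗ gᵗ Y) λ L ρ → IsInterior.g-· (𝔅.ℬ-isInterior L) (ρ 0) (ρ 1)
        ; g-≤ = law₁ (gᵗ X ·ᵗ X) (gᵗ X) λ L ρ → IsInterior.g-≤ (𝔅.ℬ-isInterior L) (ρ 0)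
        ; g-g = law₁ (gᵗ (gᵗ X)) (gᵗ X) λ L ρ → IsInterior.g-g (𝔅.ℬ-isInterior L) (ρ 0)
        }

      grz : ∀ x → InteriorProperties.Grz A isInterior x
      grz = law₁ grzᵗ (grzᵗ ·ᵗ X) λ L ρ →
        Grz⇒Holds (𝔅.ℬ L) (𝔅.ℬ-isInterior L) ρ (𝔅.Fr-Grz L (ρ 0))

  abstract

    opens∈𝕍 : ∀ 𝐀 → opens (proj₁ 𝐀) (isInterior 𝐀) ∈ᵛ 𝕍
    opens∈𝕍 𝐀 s t p ρ =
        trans (sym (eval′-T (proj₁ 𝐀) (isInterior 𝐀) ρ s)) (trans
          (law 𝐀 (T s) (T t) (λ L σ → 𝔅.≃-trans (𝔅.eval-T L σ s) (𝔅.≃-trans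
            (𝔅.ι-cong (proj₂ L s t p _)) (𝔅.≃-sym (𝔅.eval-T L σ t)))) ρ)
          (eval′-T (proj₁ 𝐀) (isInterior 𝐀) ρ t))
      where open Algebra (proj₁ 𝐀)

  O : 𝕎-Algebra → 𝕍-Algebra
  O 𝐀 = opens (proj₁ 𝐀) (isInterior 𝐀) , opens∈𝕍 𝐀

  Oʰ : ∀ 𝐀 𝐁 → Hom (proj₁ 𝐀) (proj₁ 𝐁) → Hom (proj₁ (O 𝐀)) (proj₁ (O 𝐁))
  Oʰ 𝐀 𝐁 = opensHom (isInterior 𝐀) (isInterior 𝐁)

  module _ (L : 𝕍-Algebra) where

    η : Hom (proj₁ L) (proj₁ (O (B L)))
    η = 𝔅.ιʰ L (isInterior (B L))

    η⁻¹ : Hom (proj₁ (O (B L))) (proj₁ L)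
    η⁻¹ = 𝔅.gᴸʰ L (isInterior (B L))

    transpose : ∀ 𝐀 → Hom (proj₁ L) (proj₁ (O 𝐀)) → Hom (𝔅.ℬ L) (proj₁ 𝐀)
    transpose 𝐀 f = 𝔅.Transpose.transpose L (isInterior 𝐀) f

  ε : ∀ 𝐀 → Hom (𝔅.ℬ (O 𝐀)) (proj₁ 𝐀)
  ε 𝐀 = transpose (O 𝐀) 𝐀 idʰ

  ε-injective : ∀ 𝐀 → Injective (ε 𝐀)
  ε-injective 𝐀 = 𝔅.Transpose.transpose-injective (O 𝐀) (isInterior 𝐀) idʰ id

  module _ (L M : 𝕍-Algebra) (f : Hom (proj₁ L) (proj₁ M)) where

    private
      module M = Algebra (proj₁ M)

    abstract

      Bʰ : Hom (𝔅.ℬ L) (𝔅.ℬ M)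
      Bʰ = transpose L (B M) (η M ∘ʰ f)

      Bʰ-ι : ∀ a → 𝔅._≃_ M (fun Bʰ (𝔅.ι a)) (𝔅.ι (fun f a))
      Bʰ-ι a = 𝔅.g-ι M (fun f a)

      -- `Bʰ` commutes with `g` and acts as `f` on opens. This is the naturality of `η⁻¹`.
      gᴸ-natural : ∀ x → 𝔅.gᴸ M (fun Bʰ x) M.≈ fun f (𝔅.gᴸ L x)
      gᴸ-natural x = 𝔅.ι-injective M (𝔅.≃-trans
        (𝔅.≃-sym (InteriorHom.g-homo Bʰ x)) (Bʰ-ι _))

      gᴸ-↔⇒Bʰ-≃ : ∀ x y → fun f (𝔅.gᴸ L (InteriorProperties._↔_ (𝔅.ℬ L) (𝔅.ℬ-isInterior L) x y)) M.≈
                           fun f (HeytingOperations.⊤ (proj₁ L)) →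
                   𝔅._≃_ M (fun Bʰ x) (fun Bʰ y)
      gᴸ-↔⇒Bʰ-≃ x y p =
        𝔅.Transpose.gᴸ≈⊤⇒⟦⟧-≈ L (isInterior (B M)) (η M ∘ʰ f) x y (Hom.cong (η M) p)

      Bʰ-surjective : Surjective f → Surjective Bʰ
      Bʰ-surjective sur = go
        where
        open 𝔅
        go : Surjective Bʰ
        go (ι b)   = let a , p = sur b in ι a , ≃-trans (Bʰ-ι a) (ι-cong p)
        go (x + y) = let u , p = go x ; v , q = go y in u + v , +-cong p q
        go (x · y) = let u , p = go x ; v , q = go y in u · v , ·-cong p q
        go (- x)   = let u , p = go x in - u , -‿cong p
        go 𝟙       = 𝟙 , ≃-refl
        go 𝟘       = 𝟘 , ≃-refl

  -- Finite presentability and projectivity pass from `L` to `ℬ L`.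

  module _ (L : 𝕍-Algebra) where

    private
      module L = Algebra (proj₁ L)

    -- Homomorphisms from `ℬ L` to `C` correspond to those from `L` to the opens of `C`. The
    -- translated relations see only the interiors of the generators, so further relations declare
    -- the generators open.
    B-finitelyPresented : FinitelyPresented 𝕍 (proj₁ L) → FinitelyPresented 𝕎 (𝔅.ℬ L)
    B-finitelyPresented fp = record
      { #gens     = #gens
      ; relations = translated ++ tabulate (λ i → gᵗ (var i) , var i)
      ; gens      = 𝔅.ι ∘ gens
      ; satisfied = All.++⁺
          (All.map⁺ (All.map (λ {(s , t)} p → 𝔅.≃-trans (eval-T-gens s)
            (𝔅.≃-trans (𝔅.ι-cong p) (𝔅.≃-sym (eval-T-gens t)))) satisfied))
          (All.tabulate⁺ (λ i → 𝔅.g-ι L (gens i)))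
      ; extend    = λ C C∈𝕎 c holds →
          let module C = Algebra C
              I     = isInterior (C , C∈𝕎)
              h , p = extend (opens C I) (opens∈𝕍 (C , C∈𝕎)) c
                (All.map (λ {(s , t)} → Holds-T C I c s t) (All.map⁻ (All.++⁻ˡ translated holds)))
          in transpose L (C , C∈𝕎) h , λ i → C.trans (p i) (C.trans
               (C.sym (interp-η₁ C gˢ _)) (All.tabulate⁻ (All.++⁻ʳ translated holds) i))
      ; unique    = λ C C∈𝕎 h k p →
          let module C  = InteriorOperations C
              module CP = InteriorProperties C (isInterior (C , C∈𝕎))
              restrict  = λ (h : Hom (𝔅.ℬ L) C) → Oʰ (B L) (C , C∈𝕎) h ∘ʰ η L
              open-ι : (h : Hom (𝔅.ℬ L) C) (a : L.Carrier) → C.g (fun h (𝔅.ι a)) C.≈ fun h (𝔅.ι a)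
              open-ι h a = C.trans (C.sym (InteriorHom.g-homo h (𝔅.ι a))) (Hom.cong h (𝔅.g-ι L a))
          in 𝔅.Hom-≈ L {h = h} {k} (isInterior (C , C∈𝕎)) λ a →
               C.trans (C.sym (open-ι h a)) (C.trans
                 (unique (proj₁ (O (C , C∈𝕎))) (opens∈𝕍 (C , C∈𝕎)) (restrict h) (restrict k)
                   (λ i → CP.g-cong (p i)) a)
                 (open-ι k a))
      }
      where
      open FinitelyPresented fp
      translated = map (λ (s , t) → T s , T t) relations
      eval-T-gens : ∀ t → 𝔅._≃_ L (Algebra.eval (𝔅.ℬ L) (𝔅.ι ∘ gens) (T t))
                                  (𝔅.ι (L.eval gens t))
      eval-T-gens t = 𝔅.≃-trans (𝔅.eval-T L (𝔅.ι ∘ gens) t)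
        (𝔅.ι-cong (eval-cong (proj₁ L) (λ i → 𝔅.gᴸ-ι L (isInterior (B L)) (gens i)) t))

    -- A left adjoint preserves projectivity when its right adjoint preserves surjections: transpose
    -- `f`, lift it through the map induced by `q` on opens, and transpose back.
    B-projective : Projective 𝕍 (proj₁ L) → Projective 𝕎 (𝔅.ℬ L)
    B-projective proj C D C∈𝕎 D∈𝕎 q sur f =
        transpose L 𝐂 h , 𝔅.Hom-≈ L {h = q ∘ʰ transpose L 𝐂 h} {f} (isInterior 𝐃) λ a →
          D.trans (InteriorHom.g-homo q _) (D.trans (p a)
            (D.trans (D.sym (InteriorHom.g-homo f (𝔅.ι a))) (Hom.cong f (𝔅.g-ι L a))))
      where
      𝐂 = C , C∈𝕎
      𝐃 = D , D∈𝕎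
      module D  = Algebra D
      module DP = InteriorProperties D (isInterior 𝐃)
      lift = proj (proj₁ (O 𝐂)) (proj₁ (O 𝐃)) (opens∈𝕍 𝐂) (opens∈𝕍 𝐃) (Oʰ 𝐂 𝐃 q)
        -- Any preimage of `d` under `q` represents an open whose image is the open represented by
        -- `d`.
        (λ d → let c , r = sur d in c , DP.g-cong r) (Oʰ (B L) 𝐃 f ∘ʰ η L)
      h = proj₁ lift
      p = proj₂ lift

  -- Finite presentability and projectivity pass from `A` to its opens.

  module _ (locallyFinite : LocallyFinite 𝕎)
           (𝐀 : 𝕎-Algebra) (fp : FinitelyPresented 𝕎 (proj₁ 𝐀)) where

    private
      A = proj₁ 𝐀
      module A  = InteriorOperations A
      module AP = InteriorProperties A (isInterior 𝐀)
      generated = finitelyPresented⇒finitelyGenerated 𝕎 (proj₂ 𝐀) fp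
      finite = locallyFinite A (proj₂ 𝐀) generated

    -- Local finiteness makes `A` finite, and all opens are in the image because `ε` sends `ι y` to
    -- `g y`.
    ε-surjective : Surjective (ε 𝐀)
    ε-surjective = InteriorHom.open-surjective⇒surjective (ε 𝐀) (isInterior 𝐀) (grz 𝐀) finite
      (λ y → 𝔅.ι y , A.refl)

    open Inverse (ε 𝐀) (ε-injective 𝐀) ε-surjective public using ()
      renaming (inverse to ε⁻¹; inverseʳ to ε-ε⁻¹; inverseˡ to ε⁻¹-ε)

    gᴸ-ε⁻¹ : ∀ x → A.g (𝔅.gᴸ (O 𝐀) (fun ε⁻¹ x)) A.≈ A.g x
    gᴸ-ε⁻¹ x = A.trans (InteriorHom.g-homo (ε 𝐀) (fun ε⁻¹ x)) (AP.g-cong (ε-ε⁻¹ x))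

    -- `Bʰ` keeps `q` surjective and `ε⁻¹` makes `f` a map out of `A`, so projectivity of `A` gives
    -- a lift. Its restriction to opens followed by `η⁻¹` is the required map.
    O-projective : Projective 𝕎 A → Projective 𝕍 (proj₁ (O 𝐀))
    O-projective proj C D C∈𝕍 D∈𝕍 q sur f =
        η⁻¹ 𝐂 ∘ʰ Oʰ 𝐀 (B 𝐂) h , λ x → D.trans (D.sym (gᴸ-natural 𝐂 𝐃 q (fun h x)))
          (D.trans (𝔅.gᴸ-cong 𝐃 (p x))
            (D.trans (gᴸ-natural (O 𝐀) 𝐃 f (fun ε⁻¹ x)) (Hom.cong f (gᴸ-ε⁻¹ x))))
      where
      𝐂 = C , C∈𝕍
      𝐃 = D , D∈𝕍
      module D = Algebra D
      lift = proj (𝔅.ℬ 𝐂) (𝔅.ℬ 𝐃) (proj₂ (B 𝐂)) (proj₂ (B 𝐃)) (Bʰ 𝐂 𝐃 q)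
        (Bʰ-surjective 𝐂 𝐃 q sur) (Bʰ (O 𝐀) 𝐃 f ∘ʰ ε⁻¹)
      h = proj₁ lift
      p = proj₂ lift

    -- The whole of O A serves as set of generators.  Over the free algebra on
    -- them, the generators of A lift to Boolean combinations of opens, so that
    -- a relation s ≐ t of A becomes the Heyting relation gᴸ (s ↔ t) ≐ ⊤.
    O-finitelyPresented : FinitelyPresented 𝕍 (proj₁ (O 𝐀))
    O-finitelyPresented = record
      { #gens     = n
      ; relations = translated ++ tabulate definition
      ; gens      = e
      ; satisfied = All.++⁺
          (All.map⁺ (All.map (λ {(s , t)} p → π̂.⟦⟧-≈⇒gᴸ≈⊤ (E.eval β s) (E.eval β t)
            (A.trans (π̂-eval s) (A.trans p (A.sym (π̂-eval t))))) satisfied))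
          (All.tabulate⁺ (λ i → A.trans (π̂.⟦⟧-g (E.eval β (τ i)))
            (AP.g-cong (A.trans (π̂-eval (τ i)) (τ-correct i)))))
      ; extend    = extendᴼ
      -- Every element equals some `e i`, so agreement on the generators is agreement everywhere.
      ; unique    = λ C C∈𝕍 h k p x →
          let module C = Algebra C
              i , q    = covers x
          in C.trans (Hom.cong h (AP.g-cong (A.sym q)))
               (C.trans (p i) (Hom.cong k (AP.g-cong q)))
      }
      where
      open FinitelyPresented fp
      n = proj₁ finite
      e = proj₁ (proj₂ finite)
      covers = proj₂ (proj₂ finite)
      open Free 𝕍 (Fin n) using (free; free∈W; freeHom)

      𝐅 : 𝕍-Algebra
      𝐅 = free , free∈W

      π : Hom free (proj₁ (O 𝐀))
      π = freeHom (proj₁ (O 𝐀)) (proj₂ (O 𝐀)) e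

      π̂ : Hom (𝔅.ℬ 𝐅) A
      π̂ = transpose 𝐅 𝐀 π

      module π̂ = 𝔅.Transpose 𝐅 (isInterior 𝐀) π

      π̂-surjective : Surjective π̂
      π̂-surjective = InteriorHom.open-surjective⇒surjective π̂ (isInterior 𝐀) (grz 𝐀) finite
        (λ y → let i , p = covers y in 𝔅.ι (var i) , AP.g-cong p)

      module E  = InteriorOperations (𝔅.ℬ 𝐅)
      module EP = InteriorProperties (𝔅.ℬ 𝐅) (𝔅.ℬ-isInterior 𝐅)

      β : Fin #gens → E.Carrier
      β i = proj₁ (π̂-surjective (gens i))

      π̂-eval : ∀ t → fun π̂ (E.eval β t) A.≈ A.eval gens t
      π̂-eval t = A.trans (eval-hom π̂ β t)
        (eval-cong A (λ i → proj₂ (π̂-surjective (gens i))) t)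

      τ : Fin n → Term InteriorSignature (Fin #gens)
      τ i = proj₁ (proj₂ (proj₂ generated) (e i))

      τ-correct : ∀ i → A.eval gens (τ i) A.≈ e i
      τ-correct i = proj₂ (proj₂ (proj₂ generated) (e i))

      translated : List (Term HeytingSignature (Fin n) × Term HeytingSignature (Fin n))
      translated = map (λ (s , t) → 𝔅.gᴸ 𝐅 (E.eval β s EP.↔ E.eval β t) , op ⊤ˢ V.[]) relations

      -- Ties the generator `e i` to the term `τ i` that expresses it in the generators of `A`.
      definition : Fin n → Term HeytingSignature (Fin n) × Term HeytingSignature (Fin n)
      definition i = 𝔅.gᴸ 𝐅 (E.eval β (τ i)) , var i

      -- The assignment `c` extends to the free algebra and from there to `φ̂`. The translated
      -- relations let `φ̂ ∘ β` extend to `h` on `A`; restricted to opens and followed by `η⁻¹`, it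
      -- takes the values `c` by the relations `definition`.
      extendᴼ : ∀ C → C ∈ᵛ 𝕍 → (c : Fin n → Algebra.Carrier C) →
                All (Holds C c) (translated ++ tabulate definition) →
                Σ[ h ∈ Hom (proj₁ (O 𝐀)) C ] (∀ i → Algebra._≈_ C (fun h (e i)) (c i))
      extendᴼ C C∈𝕍 c holds = η⁻¹ 𝐂 ∘ʰ Oʰ 𝐀 (B 𝐂) h , λ i →
          C.trans (𝔅.gᴸ-cong 𝐂 (h-e i)) (C.trans (gᴸ-natural 𝐅 𝐂 φ (E.eval β (τ i)))
            (All.tabulate⁻ (All.++⁻ʳ translated holds) i))
        where
        𝐂 : 𝕍-Algebra
        𝐂 = C , C∈𝕍

        module C  = Algebra C
        module BC = Algebra (𝔅.ℬ 𝐂)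

        φ : Hom free C
        φ = freeHom C C∈𝕍 c

        φ̂ : Hom (𝔅.ℬ 𝐅) (𝔅.ℬ 𝐂)
        φ̂ = Bʰ 𝐅 𝐂 φ

        φ̂-holds : ∀ s t → Holds C c (𝔅.gᴸ 𝐅 (E.eval β s EP.↔ E.eval β t) , op ⊤ˢ V.[]) →
                  Holds (𝔅.ℬ 𝐂) (fun φ̂ ∘ β) (s , t)
        φ̂-holds s t p = BC.trans (BC.sym (eval-hom φ̂ β s)) (BC.trans
          (gᴸ-↔⇒Bʰ-≃ 𝐅 𝐂 φ (E.eval β s) (E.eval β t)
            (C.trans p (C.sym (Hom.homo φ ⊤ˢ V.[]))))
          (eval-hom φ̂ β t))

        lift = extend (𝔅.ℬ 𝐂) (proj₂ (B 𝐂)) (fun φ̂ ∘ β)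
          (All.map (λ {(s , t)} → φ̂-holds s t) (All.map⁻ (All.++⁻ˡ translated holds)))

        h : Hom A (𝔅.ℬ 𝐂)
        h = proj₁ lift

        h-e : ∀ i → fun h (e i) BC.≈ fun φ̂ (E.eval β (τ i))
        h-e i = BC.trans (Hom.cong h (A.sym (τ-correct i))) (BC.trans (eval-hom h gens (τ i))
          (BC.trans (eval-cong (𝔅.ℬ 𝐂) (proj₂ lift) (τ i)) (BC.sym (eval-hom φ̂ β (τ i)))))

  module _ (L : 𝕍-Algebra) (𝐂 : 𝕎-Algebra) (w : Hom (𝔅.ℬ L) (proj₁ 𝐂)) where

    private
      module C = InteriorOperations (proj₁ 𝐂)

      f : Hom (proj₁ L) (proj₁ (O 𝐂))
      f = Oʰ (B L) 𝐂 w ∘ʰ η L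

    -- Half of the adjunction bijection: `w` is recovered from its restriction to opens. On `ι a`
    -- both sides are `w (g (ι a))`.
    ε-transpose : ∀ x → fun (ε 𝐂) (fun (Bʰ L (O 𝐂) f) x) C.≈ fun w x
    ε-transpose = 𝔅.Hom-≈ L {h = ε 𝐂 ∘ʰ Bʰ L (O 𝐂) f} {w} (isInterior 𝐂) ε-transpose-ι
      where
      ε-transpose-ι : ∀ a → fun (ε 𝐂) (fun (Bʰ L (O 𝐂) f) (𝔅.ι a)) C.≈ fun w (𝔅.ι a)
      ε-transpose-ι a = C.trans
        (Hom.cong (ε 𝐂) {fun (Bʰ L (O 𝐂) f) (𝔅.ι a)} {𝔅.ι (fun f a)} (Bʰ-ι L (O 𝐂) f a))
        (C.trans (C.sym (InteriorHom.g-homo w (𝔅.ι a))) (Hom.cong w (𝔅.g-ι L a)))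

  module _ (L M N : 𝕍-Algebra) (f : Hom (proj₁ L) (proj₁ M)) (h : Hom (proj₁ M) (proj₁ N))
           (k : Hom (proj₁ L) (proj₁ N))
           (k≈h∘f : ∀ a → Algebra._≈_ (proj₁ N) (fun k a) (fun h (fun f a))) where

    -- Functoriality, for a factorisation up to `≈` as a comparison of unifiers provides it.
    Bʰ-∘ : ∀ x → 𝔅._≃_ N (fun (Bʰ L N k) x) (fun (Bʰ M N h) (fun (Bʰ L M f) x))
    Bʰ-∘ = 𝔅.Hom-≈ L {h = Bʰ L N k} {Bʰ M N h ∘ʰ Bʰ L M f} (isInterior (B N)) Bʰ-∘-ι
      where
      open SetoidReasoning (Algebra.setoid (𝔅.ℬ N))
      Bʰ-∘-ι : ∀ a → 𝔅._≃_ N (fun (Bʰ L N k) (𝔅.ι a)) (fun (Bʰ M N h) (fun (Bʰ L M f) (𝔅.ι a)))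
      Bʰ-∘-ι a = begin
        fun (Bʰ L N k) (𝔅.ι a)                   ≈⟨ Bʰ-ι L N k a ⟩
        𝔅.ι (fun k a)                            ≈⟨ 𝔅.ι-cong (k≈h∘f a) ⟩
        𝔅.ι (fun h (fun f a))                    ≈⟨ Bʰ-ι M N h (fun f a) ⟨
        fun (Bʰ M N h) (𝔅.ι (fun f a))           ≈⟨ Hom.cong (Bʰ M N h) (Bʰ-ι L M f a) ⟨
        fun (Bʰ M N h) (fun (Bʰ L M f) (𝔅.ι a))  ∎

  -- Transfer of unifiers and of unification types.

  module _ (locallyFinite : LocallyFinite 𝕎) where

    module _ (𝐋 : 𝕍-Algebra) (𝐀 : 𝕎-Algebra)
             (i : Hom (𝔅.ℬ 𝐋) (proj₁ 𝐀)) (j : Hom (proj₁ 𝐀) (𝔅.ℬ 𝐋))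
             (i-j : ∀ x → Algebra._≈_ (proj₁ 𝐀) (fun i (fun j x)) x)
             (j-i : ∀ x → 𝔅._≃_ 𝐋 (fun j (fun i x)) x) where

      open Unifier

      private
        L = proj₁ 𝐋
        A = proj₁ 𝐀

        targetᵛ : Unifier 𝕍 L → 𝕍-Algebra
        targetᵛ u = target u , target∈W u

        targetʷ : Unifier 𝕎 A → 𝕎-Algebra
        targetʷ w = target w , target∈W w

        toᵘ : Unifier 𝕍 L → Unifier 𝕎 A
        toᵘ u = record
          { target            = 𝔅.ℬ (targetᵛ u)
          ; target∈W          = proj₂ (B (targetᵛ u))
          ; finitelyPresented = B-finitelyPresented (targetᵛ u) (finitelyPresented u)
          ; projective        = B-projective (targetᵛ u) (projective u)
          ; unifier           = Bʰ 𝐋 (targetᵛ u) (unifier u) ∘ʰ j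
          }

        fromᵘ : Unifier 𝕎 A → Unifier 𝕍 L
        fromᵘ w = record
          { target            = proj₁ (O (targetʷ w))
          ; target∈W          = proj₂ (O (targetʷ w))
          ; finitelyPresented = O-finitelyPresented locallyFinite (targetʷ w) (finitelyPresented w)
          ; projective        = O-projective locallyFinite (targetʷ w) (finitelyPresented w) (projective w)
          ; unifier           = Oʰ (B 𝐋) (targetʷ w) (unifier w ∘ʰ i) ∘ʰ η 𝐋
          }

        to-mono : ∀ {u v} → _≽_ 𝕍 u v → _≽_ 𝕎 (toᵘ u) (toᵘ v)
        to-mono {u} {v} (h , p) = Bʰ (targetᵛ u) (targetᵛ v) h , λ x →
          Bʰ-∘ 𝐋 (targetᵛ u) (targetᵛ v) (unifier u) h (unifier v) p (fun j x)

        from-mono : ∀ {w z} → _≽_ 𝕎 w z → _≽_ 𝕍 (fromᵘ w) (fromᵘ z)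
        from-mono {w} {z} (h , p) = Oʰ (targetʷ w) (targetʷ z) h , λ a →
          InteriorProperties.g-cong (target z) (isInterior (targetʷ z)) (p (fun i (𝔅.ι a)))

        from-to : ∀ u a → 𝔅._≃_ (targetᵛ u)
          (fun (Bʰ 𝐋 (targetᵛ u) (unifier u)) (fun j (fun i (𝔅.ι a)))) (𝔅.ι (fun (unifier u) a))
        from-to u a = 𝔅.≃-trans (Hom.cong (Bʰ 𝐋 (targetᵛ u) (unifier u)) (j-i (𝔅.ι a)))
          (Bʰ-ι 𝐋 (targetᵛ u) (unifier u) a)

        to-from : ∀ w x → Algebra._≈_ (target w)
          (fun (ε (targetʷ w)) (fun (unifier (toᵘ (fromᵘ w))) x)) (fun (unifier w) x)
        to-from w x = Algebra.trans (target w)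
          (ε-transpose 𝐋 (targetʷ w) (unifier w ∘ʰ i) (fun j x))
          (Hom.cong (unifier w) (i-j x))

      -- Stating this for any isomorphism between `ℬ L` and `A` covers both uses: `A` equal to `ℬ L`
      -- with identities, and `L` equal to `O A` with `ε`. The comparisons are `η`, `ε` and their
      -- inverses.
      unifier-equivalence : QuasiorderEquivalence (_≽_ 𝕍 {L}) (_≽_ 𝕎 {A})
      unifier-equivalence = record
        { ≽-trans   = λ {u} {v} {w} → ≽-transitive 𝕍 {u = u} {v} {w}
        ; ⊒-trans   = λ {u} {v} {w} → ≽-transitive 𝕎 {u = u} {v} {w}
        ; to        = toᵘ
        ; from      = fromᵘ
        ; to-mono   = λ {u} {v} → to-mono {u} {v}
        ; from-mono = λ {u} {v} → from-mono {u} {v}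
        ; from-to-≽ = λ u → η⁻¹ (targetᵛ u) , λ a → Algebra.sym (target u)
            (Algebra.trans (target u) (𝔅.gᴸ-cong (targetᵛ u) (from-to u a))
              (𝔅.gᴸ-ι (targetᵛ u) (isInterior (B (targetᵛ u))) (fun (unifier u) a)))
        ; ≽-from-to = λ u → η (targetᵛ u) , λ a → 𝔅.g-cong (targetᵛ u) (from-to u a)
        ; to-from-⊒ = λ w → ε (targetʷ w) , λ x → Algebra.sym (target w) (to-from w x)
        ; ⊒-to-from = λ w → ε⁻¹ locallyFinite (targetʷ w) (finitelyPresented w) , λ x →
            𝔅.≃-trans
              (𝔅.≃-sym (ε⁻¹-ε locallyFinite (targetʷ w) (finitelyPresented w) _))
              (Hom.cong (ε⁻¹ locallyFinite (targetʷ w) (finitelyPresented w)) (to-from w x))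
        }

      -- Transferred μ-sets keep their index types, so the cardinality conditions carry over as they
      -- are; type 0 follows by contraposition.
      algebraType : ∀ τ → HasAlgebraType 𝕍 L τ ⇔ HasAlgebraType 𝕎 A τ
      algebraType = λ where
          type-1 → mk⇔ (Product.map to-μ id) (Product.map from-μ id)
          type-ω → mk⇔ (Product.map to-μ id) (Product.map from-μ id)
          type-∞ → mk⇔ (Product.map to-μ id) (Product.map from-μ id)
          type-0 → mk⇔ (_∘ from-μ) (_∘ to-μ)
        where
        open QuasiorderEquivalence unifier-equivalence
        module Flip = QuasiorderEquivalence flip

        to-μ : μ-Set 𝕍 L → μ-Set 𝕎 A
        to-μ M = record
          { Index     = Index
          ; member    = to ∘ member
          ; antichain = to-antichain member antichain
          ; dense     = to-dense member dense
          }
          where open μ-Set M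

        from-μ : μ-Set 𝕎 A → μ-Set 𝕍 L
        from-μ M = record
          { Index     = Index
          ; member    = from ∘ member
          ; antichain = Flip.to-antichain member antichain
          ; dense     = Flip.to-dense member dense
          }
          where open μ-Set M

    module _ (U : UnifiableAlgebra 𝕍) where

      open UnifiableAlgebra U

      private
        𝐋 : 𝕍-Algebra
        𝐋 = algebra , algebra∈W

        equivalence = unifier-equivalence 𝐋 (B 𝐋) idʰ idʰ (λ _ → 𝔅.≃-refl) (λ _ → 𝔅.≃-refl)

      B-unifiable : UnifiableAlgebra 𝕎
      B-unifiable = record
        { algebra           = 𝔅.ℬ 𝐋
        ; algebra∈W         = proj₂ (B 𝐋)
        ; finitelyPresented = B-finitelyPresented 𝐋 finitelyPresented
        ; someUnifier       = QuasiorderEquivalence.to equivalence someUnifier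
        }

      B-type : ∀ τ → HasAlgebraType 𝕍 algebra τ ⇔
                     HasAlgebraType 𝕎 (UnifiableAlgebra.algebra B-unifiable) τ
      B-type = algebraType 𝐋 (B 𝐋) idʰ idʰ (λ _ → 𝔅.≃-refl) (λ _ → 𝔅.≃-refl)

    module _ (U : UnifiableAlgebra 𝕎) where

      open UnifiableAlgebra U

      private
        𝐀 : 𝕎-Algebra
        𝐀 = algebra , algebra∈W

        inv = ε⁻¹ locallyFinite 𝐀 finitelyPresented
        invʳ = ε-ε⁻¹ locallyFinite 𝐀 finitelyPresented
        invˡ = ε⁻¹-ε locallyFinite 𝐀 finitelyPresented

      O-unifiable : UnifiableAlgebra 𝕍
      O-unifiable = record
        { algebra           = proj₁ (O 𝐀)
        ; algebra∈W         = proj₂ (O 𝐀)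
        ; finitelyPresented = O-finitelyPresented locallyFinite 𝐀 finitelyPresented
        ; someUnifier       = QuasiorderEquivalence.from
            (unifier-equivalence (O 𝐀) 𝐀 (ε 𝐀) inv invʳ invˡ) someUnifier
        }

      O-type : ∀ τ → HasAlgebraType 𝕍 (UnifiableAlgebra.algebra O-unifiable) τ ⇔
                     HasAlgebraType 𝕎 algebra τ
      O-type = algebraType (O 𝐀) 𝐀 (ε 𝐀) inv invʳ invˡ

    -- For a universal clause each algebra of the target variety is moved to the source variety; for
    -- an existential clause the witness is moved the other way.
    unificationType : ∀ τ → HasUnificationType 𝕍 τ ⇔ HasUnificationType 𝕎 τ
    unificationType = λ where
        unitary    → mk⇔ (λ p A → O-to A type-1 (p (O-unifiable A)))
                         (λ p L → B-from L type-1 (p (B-unifiable L)))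
        finitary   → mk⇔
          (λ (p , q) → (λ A → Sum.map (O-to A type-1) (O-to A type-ω) (p (O-unifiable A))) , B-some type-ω q)
          (λ (p , q) → (λ L → Sum.map (B-from L type-1) (B-from L type-ω) (p (B-unifiable L))) , O-some type-ω q)
        infinitary → mk⇔
          (λ (p , q) → (λ A → Sum.map (O-to A type-1) (Sum.map (O-to A type-ω) (O-to A type-∞))
                                (p (O-unifiable A))) , B-some type-∞ q)
          (λ (p , q) → (λ L → Sum.map (B-from L type-1) (Sum.map (B-from L type-ω) (B-from L type-∞))
                                (p (B-unifiable L))) , O-some type-∞ q)
        nullary    → mk⇔ (B-some type-0) (O-some type-0)
      where
      open UnifiableAlgebra using (algebra)
      O-to : ∀ U τ → HasAlgebraType 𝕍 (algebra (O-unifiable U)) τ → HasAlgebraType 𝕎 (algebra U) τ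
      O-to U τ = Equivalence.to (O-type U τ)
      B-from : ∀ U τ → HasAlgebraType 𝕎 (algebra (B-unifiable U)) τ → HasAlgebraType 𝕍 (algebra U) τ
      B-from U τ = Equivalence.from (B-type U τ)
      B-some : ∀ τ → ∃[ U ] HasAlgebraType 𝕍 (algebra U) τ → ∃[ U ] HasAlgebraType 𝕎 (algebra U) τ
      B-some τ (U , p) = B-unifiable U , Equivalence.to (B-type U τ) p
      O-some : ∀ τ → ∃[ U ] HasAlgebraType 𝕎 (algebra U) τ → ∃[ U ] HasAlgebraType 𝕍 (algebra U) τ
      O-some τ (U , p) = O-unifiable U , Equivalence.from (O-type U τ) p

theorem5p8 : (V : HeytingVariety) →
    LocallyFinite (ρ* V) →
    ∀ (τ : UnificationType) →
    HasUnificationType (HeytingVariety.variety V) τ ⇔ HasUnificationType (ρ* V) τ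
theorem5p8 V locallyFinite = Companion.unificationType V locallyFinite
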